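{- Let $P,Q\in\mathbb Z$, $Q\ne0$, $f(t)=t^2-Pt+Q$ with roots $\theta_1,\theta_2$, $D=P^2-4Q\ne0$, $p$ a prime with $p\nmid Q$, and $r(p)$ the rank of the Lucas sequence. Let $G(f,p)\le K(f,p)\le G_{\mathbb Q}(f)$ and $G^*(f,p)\le K^*(f,p)\le G^*_{\mathbb Q}(f)$ be as in the context. (1) If $f\bmod p$ is irreducible over $\mathbb F_p$, then $K(f,p)/G(f,p)\simeq\mathbb F_p(\theta_1)^\times/\mathbb F_p^\times\simeq\mathbb Z/(p+1)\mathbb Z$ via $[w_1:w_0]\mapsto w_1-w_0\theta_1\bmod\mathbb F_p^\times$, and $K^*(f,p)/G^*(f,p)\simeq\mathbb F_p(\theta_1)^\times/\mathbb F_p^\times\langle\theta_1\rangle\simeq\mathbb Z/((p+1)/r(p))\mathbb Z$ via $[w_1:w_0]\mapsto w_1-w_0\theta_1\bmod\mathbb F_p^\times\langle\theta_1\rangle$. (2) Suppose $f\bmod p$ is reducible over $\mathbb F_p$. If $p\nmid D$, then $K(f,p)/G(f,p)\simeq\mathbb F_p^\times\simeq\mathbb Z/(p-1)\mathbb Z$ via $[w_1:w_0]\mapsto(w_1-w_0\theta_1)(w_1-w_0\theta_2)^{ -1}$, and $K^*(f,p)/G^*(f,p)\simeq\mathbb F_p^\times/\langle\theta_1\theta_2^{ -1}\rangle\simeq\mathbb Z/((p-1)/r(p))\mathbb Z$ via the same map modulo $\langle\theta_1\theta_2^{ -1}\rangle$. If $p\mid D$, then $K(f,p)/G(f,p)\simeq\mathbb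 F_p$ via $[w_1:w_0]\mapsto -w_0(w_1-w_0\theta)^{ -1}$, where $\theta$ is the double root of $f\bmod p$, and $K^*(f,p)/G^*(f,p)$ is trivial.
   Context: $\mathscr S(f,R)^{\times}$ (for $R=\mathbb Q$ or $\mathbb F_p$) is the set of sequences $(w_n)_{n\in\mathbb Z}$ in $R$ with $w_{n+2}-Pw_{n+1}+Qw_n=0$ and $\Lambda(w_1,w_0):=w_1^2-Pw_0w_1+Qw_0^2\in R^\times$, a group under $(w_n)*(v_n)=(u_n)$, $u_1=w_1v_1-Qw_0v_0$, $u_0=w_0v_1+w_1v_0-Pw_0v_0$. $G_R(f)$ is its quotient by ${\bf w}\sim{\bf v}\iff w_n=\lambda v_n$ for all $n$ ($\lambda\in R^\times$), and $G^*_R(f)$ its quotient by $w_n=\lambda v_{n+\nu}$ for all $n$ ($\lambda\in R^\times$, $\nu\in\mathbb Z$); $[w_1:w_0]$ denotes the class with initial terms $w_1,w_0$, and $\pi:G_{\mathbb Q}(f)\to G^*_{\mathbb Q}(f)$ the natural map. $\mathrm{red}_p:G_{\mathbb Q}(f)\to\mathbb P^1(\mathbb F_p)$ sends $[w_1:w_0]$ (with $w_0,w_1\in\mathbb Z$ coprime) to its reduction mod $p$; $G_{\mathbb F_p}(f)\subset\mathbb P^1(\mathbb F_p)$. $G(f,p)=\mathrm{red}_p^{ -1}([1:0])$, $K(f,p)=\mathrm{red}_p^{ -1}(G_{\mathbb F_p}(f))$, $G^*(f,p)=\pi(G(f,p))$, $K^*(f,p)=\pi(K(f,p))$. The Lucas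 sequence $\mathcal F$ has $\mathcal F_0=0,\mathcal F_1=1$ and the recurrence; its rank $r(p)$ is the least positive $n$ with $\mathcal F_n\in p\mathbb Z_{(p)}$. -}

module Defs where

open import Level using (Level)
open import Data.Nat as ℕ using (ℕ; zero; suc)
open import Data.Integer
  using (ℤ; +_; 0ℤ; 1ℤ; _+_; _-_; _*_; -_; _^_)
open import Data.Integer.Divisibility using (_∣_)
open import Data.Integer.GCD using (gcd)
open import Data.Product using (_×_; _,_; Σ; ∃; ∃-syntax)
open import Data.Unit using (⊤)
open import Relation.Binary.PropositionalEquality using (_≡_)
open import Relation.Nullary using (¬_)
open import Function.Bundles using (_⇔_)

-- A pair (w₁ , w₀) of initial terms.
Pair : Set
Pair = ℤ × ℤ

_≡[_]_ : ℤ → ℕ → ℤ → Set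
a ≡[ p ] b = (+ p) ∣ (a - b)

Λ : ℤ → ℤ → Pair → ℤ
Λ P Q (w1 , w0) = w1 * w1 - P * w0 * w1 + Q * w0 * w0

-- The product of 𝒮(f,R)^× on initial terms.
mulQ : ℤ → ℤ → Pair → Pair → Pair
mulQ P Q (w1 , w0) (v1 , v0) =
  (w1 * v1 - Q * w0 * v0 , w0 * v1 + w1 * v0 - P * w0 * v0)

-- Equality of classes [w₁:w₀] = [v₁:v₀] (proportional pairs).
_∼_ : Pair → Pair → Set
(w1 , w0) ∼ (v1 , v0) = w1 * v0 ≡ w0 * v1

Prim : Pair → Set
Prim (a , b) = gcd a b ≡ 1ℤ

-- An element [a:b] of G_ℚ(f), given by a primitive integer representative.
GQ : ℤ → ℤ → Pair → Set
GQ P Q x = Prim x × ¬ (Λ P Q x ≡ 0ℤ)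

-- G(f,p) = red_p⁻¹([1:0]).
inG : ℤ → ℤ → ℕ → Pair → Set
inG P Q p (a , b) = GQ P Q (a , b) × (+ p) ∣ b

-- K(f,p) = red_p⁻¹(G_{𝔽_p}(f)).
inK : ℤ → ℤ → ℕ → Pair → Set
inK P Q p x = GQ P Q x × ¬ ((+ p) ∣ Λ P Q x)

-- Powers of the shift class [P:1] (class of the shifted Lucas sequence).
shiftPow : ℤ → ℤ → ℕ → Pair
shiftPow P Q zero    = (1ℤ , 0ℤ)
shiftPow P Q (suc n) = mulQ P Q (P , 1ℤ) (shiftPow P Q n)

-- π x = π y in G*_ℚ(f): x and y agree up to scalars and index shift.
_≈π[_,_]_ : Pair → ℤ → ℤ → Pair → Set
x ≈π[ P , Q ] y = ∃[ m ] ∃[ n ]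
  (mulQ P Q x (shiftPow P Q m) ∼ mulQ P Q y (shiftPow P Q n))

-- π x ∈ G*(f,p) = π(G(f,p)).
inGstar : ℤ → ℤ → ℕ → Pair → Set
inGstar P Q p x = ∃[ g ] (inG P Q p g × x ≈π[ P , Q ] g)

lucas : ℤ → ℤ → ℕ → ℤ
lucas P Q zero = 0ℤ
lucas P Q (suc zero) = 1ℤ
lucas P Q (suc (suc n)) = P * lucas P Q (suc n) - Q * lucas P Q n

IsRank : ℤ → ℤ → ℕ → ℕ → Set
IsRank P Q p r =
  (0 ℕ.< r) × ((+ p) ∣ lucas P Q r)
  × (∀ m → 0 ℕ.< m → m ℕ.< r → ¬ ((+ p) ∣ lucas P Q m))

-- f mod p factors as (t − u)(t − v) over 𝔽_p.
Factors : ℤ → ℤ → ℕ → ℤ → ℤ → Set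
Factors P Q p u v = (P ≡[ p ] (u + v)) × (Q ≡[ p ] (u * v))

Reducible : ℤ → ℤ → ℕ → Set
Reducible P Q p = ∃[ u ] ∃[ v ] Factors P Q p u v

Irreducible : ℤ → ℤ → ℕ → Set
Irreducible P Q p = ¬ Reducible P Q p

disc : ℤ → ℤ → ℤ
disc P Q = P * P - + 4 * Q

record TGrp : Set₁ where
  field
    Car   : Set
    Valid : Car → Set
    _≈_   : Car → Car → Set
    _·_   : Car → Car → Car
    e     : Car

-- 𝔽_p(θ₁) = 𝔽_p[t]/(f): a + bθ₁ encoded as (a , b); product uses θ₁² = Pθ₁ − Q.
mulF : ℤ → ℤ → Pair → Pair → Pair
mulF P Q (a , b) (c , d) = (a * c - Q * b * d , a * d + b * c + P * b * d)

θpow : ℤ → ℤ → ℕ → Pair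
θpow P Q zero    = (1ℤ , 0ℤ)
θpow P Q (suc k) = mulF P Q (0ℤ , 1ℤ) (θpow P Q k)

-- 𝔽_p(θ₁)^× / 𝔽_p^×
T1 : ℤ → ℤ → ℕ → TGrp
T1 P Q p = record
  { Car = Pair
  ; Valid = λ { (a , b) → ¬ (((+ p) ∣ a) × ((+ p) ∣ b)) }
  ; _≈_ = λ { (a , b) (a' , b') → ∃[ l ] (¬ ((+ p) ∣ l)
              × (a ≡[ p ] (l * a')) × (b ≡[ p ] (l * b'))) }
  ; _·_ = mulF P Q
  ; e = (1ℤ , 0ℤ) }

-- 𝔽_p(θ₁)^× / 𝔽_p^× ⟨θ₁⟩
T1* : ℤ → ℤ → ℕ → TGrp
T1* P Q p = record
  { Car = Pair
  ; Valid = λ { (a , b) → ¬ (((+ p) ∣ a) × ((+ p) ∣ b)) }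
  ; _≈_ = λ { (a , b) (a' , b') → ∃[ l ] ∃[ k ] (¬ ((+ p) ∣ l)
              × let (c , d) = mulF P Q (θpow P Q k) (a' , b')
                in (a ≡[ p ] (l * c)) × (b ≡[ p ] (l * d))) }
  ; _·_ = mulF P Q
  ; e = (1ℤ , 0ℤ) }

-- [w₁:w₀] ↦ w₁ − w₀θ₁
φ1 : Pair → Pair
φ1 (w1 , w0) = (w1 , - w0)

-- Inverse in 𝔽_p^× (Fermat): x⁻¹ = x^(p−2).
inv : ℕ → ℤ → ℤ
inv p x = x ^ (p ℕ.∸ 2)

T2 : ℕ → TGrp
T2 p = record
  { Car = ℤ ; Valid = λ t → ¬ ((+ p) ∣ t)
  ; _≈_ = λ s t → s ≡[ p ] t ; _·_ = _*_ ; e = 1ℤ }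

-- 𝔽_p^× / ⟨θ₁θ₂⁻¹⟩  (θ₁ = u, θ₂ = v)
T2* : ℕ → ℤ → ℤ → TGrp
T2* p u v = record
  { Car = ℤ ; Valid = λ t → ¬ ((+ p) ∣ t)
  ; _≈_ = λ s t → ∃[ k ] (s ≡[ p ] (((u * inv p v) ^ k) * t))
  ; _·_ = _*_ ; e = 1ℤ }

φ2 : ℕ → ℤ → ℤ → Pair → ℤ
φ2 p u v (w1 , w0) = (w1 - w0 * u) * inv p (w1 - w0 * v)

T3 : ℕ → TGrp
T3 p = record
  { Car = ℤ ; Valid = λ _ → ⊤
  ; _≈_ = λ s t → s ≡[ p ] t ; _·_ = _+_ ; e = 0ℤ }

φ3 : ℕ → ℤ → Pair → ℤ
φ3 p θ (w1 , w0) = (- w0) * inv p (w1 - w0 * θ)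

-- φ induces an isomorphism (source quotient) ≅ T, where the source is the set K
-- inside G_ℚ(f), with class equality _≈S_ and normal subgroup Ker:
-- φ lands in T, is well defined on classes, is a homomorphism, is surjective,
-- and its kernel is exactly Ker.
IsoVia : ℤ → ℤ → (K : Pair → Set) (_≈S_ : Pair → Pair → Set) (Ker : Pair → Set)
         (T : TGrp) → (Pair → TGrp.Car T) → Set
IsoVia P Q K _≈S_ Ker T φ =
  (∀ x → K x → Valid (φ x))
  × (∀ x y → K x → K y → x ≈S y → φ x ≈ φ y)
  × (∀ x y z → K x → K y → GQ P Q z → z ∼ mulQ P Q x y
       → φ z ≈ (φ x · φ y))
  × (∀ t → Valid t → ∃[ x ] (K x × φ x ≈ t))
  × (∀ x → K x → (φ x ≈ e) ⇔ Ker x)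
  where open TGrp T

CyclicOfOrder : TGrp → ℕ → Set
CyclicOfOrder T n = Σ (ℤ → Car) λ ψ →
  (∀ m → Valid (ψ m))
  × (∀ m k → ψ (m + k) ≈ (ψ m · ψ k))
  × (∀ m k → (ψ m ≈ ψ k) ⇔ ((+ n) ∣ (m - k)))
  × (∀ t → Valid t → ∃[ m ] (ψ m ≈ t))
  where open TGrp T

{-# OPTIONS --safe #-}

-- Reduction mod p identifies K(f,p)/G(f,p) with the group of points [a:b] of ℙ¹(𝔽ₚ) with
-- Λ(a,b) ≠ 0, that is, with (𝔽ₚ[t]/f)^× / 𝔽ₚ^×; evaluation at the roots of f makes this group
-- explicit. It is cyclic because the unit group of a finite domain is: if g has maximal order n,
-- then every unit is a root of Xⁿ − 1, and the powers of g already exhaust the roots. Its order is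
-- found by counting points. Passing to the starred groups divides by the class of the shift
-- [P:1] ↦ θ₂ = Q/θ₁, whose order is r(p) since θ^k has θ-coordinate F_k; in a cyclic group of
-- order N the quotient by an element of order r is cyclic of order N/r.
module Submission where

open import Defs
open import Level using (0ℓ; _⊔_)
open import Algebra.Bundles using (CommutativeMonoid; CommutativeRing)
open import Algebra.Structures using (IsCommutativeMonoid)
open import Data.Nat.Base as ℕ
  using (ℕ; zero; suc; _∸_; _≤_; _<_; z<s; s<s; NonZero; >-nonZero; >-nonZero⁻¹; nonTrivial⇒n>1)
import Data.Nat.Properties as ℕ
import Data.Nat.Divisibility as ℕ
open import Data.Nat.DivMod using (_/_; _%_; m≡m%n+[m/n]*n; m%n<n; m*n/n≡m)
open import Data.Nat.GCD
  using (gcd; gcd-GCD; gcd[m,n]∣m; gcd[m,n]∣n; gcd-greatest; gcd[m,n]≡0⇒m≡0; gcd[m,n]≡0⇒n≡0; module Bézout)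
open import Data.Nat.Coprimality using (Coprime; coprime-divisor) renaming (sym to coprime-sym)
open import Data.Nat.Primality
  using (Prime; prime⇒nonZero; prime⇒nonTrivial; prime⇒irreducible; euclidsLemma)
open import Data.Nat.Primality.Factorisation using (factorise)
open import Data.Nat.Induction using (<-rec)
open import Data.Nat.Solver using (module +-*-Solver)
open import Data.List.Base using ([]; _∷_)
open import Data.List.Relation.Unary.All using (_∷_)
open import Data.Fin.Base as Fin using (Fin; toℕ) renaming (zero to fzero; suc to fsuc)
import Data.Fin.Properties as Fin
open import Data.Product using (∃-syntax; _×_; _,_; proj₁; proj₂)
open import Data.Sum as Sum using (_⊎_; inj₁; inj₂; [_,_]′)
open import Data.Empty using (⊥; ⊥-elim)
open import Data.Unit using (tt)
open import Relation.Nullary using (¬_; Dec; yes; no)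
open import Relation.Nullary.Decidable using (_×-dec_; ¬?; map′)
open import Relation.Binary.Definitions using (Decidable)
open import Relation.Binary.Structures using (IsEquivalence)
open import Relation.Binary.PropositionalEquality as ≡ using (_≡_; cong; cong₂; subst)
open import Function.Bundles using (_⇔_; mk⇔; Equivalence)
open Equivalence using (to; from)

-- The stated groups live on ℤ or ℤ × ℤ with a validity predicate, so a carrier may contain elements
-- without inverse, and no inverse operation is given. Orders are therefore treated in commutative
-- monoids: `HasOrder` is a divisibility criterion, and the inverse of an element of finite order is
-- one of its powers, which explains exponents such as a n - a. A maximal order is an exponent of
-- the group because an order not dividing it can be combined with it into a strictly larger one;
-- orders are bounded by the number of elements, so the enlargement stops. Products of primitive
-- pairs need not be primitive. Hence φ is studied on all integer pairs with Λ prime to p, and a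
-- primitive representative is chosen only when an element of K or G is required. For the starred
-- quotients one relation suffices: with σ = [P:1], φ(σ) is inverse to h, where h is θ₁ or θ₁θ₂⁻¹;
-- the irreducible and split cases then share one argument. If p ∣ D, the target is additive of
-- order p and φ(σ) already generates it, so K* = G*.

-- Prime powers and coprimality of natural numbers.

module _ where
  open import Data.Nat.Base using (_*_) renaming (_^_ to _^ℕ_)
  open import Data.Nat.Divisibility using (_∣_; divides; ∣-trans; m∣m*n; ∣1⇒≡1; _∣?_)

  prime-divisor : ∀ n → 1 < n → ∃[ q ] (Prime q × q ∣ n)
  prime-divisor n@(suc _) 1<n with factorise n
  ... | record { factors = [] ; isFactorisation = eq } = ⊥-elim (ℕ.<-irrefl (≡.sym eq) 1<n)
  ... | record { factors = q ∷ qs ; isFactorisation = eq ; factorsPrime = pq ∷ _ } =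
    q , pq , subst (q ∣_) (≡.sym eq) (m∣m*n _)

  remove-prime : ∀ {q} → Prime q → ∀ n → .{{NonZero n}} → ∃[ b ] ∃[ m ] (n ≡ q ^ℕ b * m × ¬ q ∣ m)
  remove-prime {q} pq n {{n≢0}} = <-rec P step n (>-nonZero⁻¹ n {{n≢0}})
    where
    P : ℕ → Set
    P n = 0 < n → ∃[ b ] ∃[ m ] (n ≡ q ^ℕ b * m × ¬ q ∣ m)
    step : ∀ n → (∀ {m} → m < n → P m) → P n
    step n rec 0<n with q ∣? n
    ... | no q∤n = 0 , n , ≡.sym (ℕ.*-identityˡ n) , q∤n
    ... | yes (divides zero ≡.refl) = ⊥-elim (ℕ.<-irrefl ≡.refl 0<n)
    ... | yes (divides k@(suc _) ≡.refl)
      with rec (ℕ.m<m*n k q (nonTrivial⇒n>1 q {{prime⇒nonTrivial pq}})) z<s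
    ...   | b , m , eq , q∤m = suc b , m , ≡.trans (ℕ.*-comm k q) (≡.trans (cong (q *_) eq) (≡.sym (ℕ.*-assoc q _ m))) , q∤m

  -- Factors q are stripped off one at a time: a common divisor of d and q is 1 or q, and q itself
  -- would divide m through d.
  prime^-coprime : ∀ {q m} → Prime q → ¬ q ∣ m → ∀ b → Coprime (q ^ℕ b) m
  prime^-coprime pq q∤m zero (d∣1 , _) = ∣1⇒≡1 d∣1
  prime^-coprime {q} {m} pq q∤m (suc b) {d} (d∣qqᵇ , d∣m) =
    prime^-coprime pq q∤m b (coprime-divisor d⊥q d∣qqᵇ , d∣m)
    where
    d⊥q : Coprime d q
    d⊥q {e} (e∣d , e∣q) with prime⇒irreducible pq e∣q
    ... | inj₁ e≡1 = e≡1
    ... | inj₂ ≡.refl = ⊥-elim (q∤m (∣-trans e∣d d∣m))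

  coprime-∣* : ∀ {m n k} → Coprime m n → m ∣ k → n ∣ k → m * n ∣ k
  coprime-∣* {m} {n} m⊥n (divides a ≡.refl) n∣am
    with coprime-divisor {o = a} (coprime-sym m⊥n) (subst (n ∣_) (ℕ.*-comm a m) n∣am)
  ... | divides b ≡.refl = divides b (≡.trans (ℕ.*-assoc b n m) (cong (b *_) (ℕ.*-comm n m)))

-- Orders of elements in a commutative monoid.

module Orders {a ℓ} (M : CommutativeMonoid a ℓ) where
  open import Data.Nat.Base using (_+_; _*_) renaming (_^_ to _^ℕ_)
  open import Data.Nat.Divisibility using (_∣_; divides; ∣-refl; ∣-trans; m∣m*n; n∣m*n; *-cancelˡ-∣; *-cancelʳ-∣; *-monoˡ-∣; *-monoʳ-∣; m%n≡0⇒n∣m; ∣1⇒≡1; ∣⇒≤)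
  open CommutativeMonoid M
  open import Algebra.Properties.CommutativeMonoid.Mult M
    renaming (_×_ to _×ᵐ_; ×-congʳ to ^-cong; ×-homo-+ to ^-+)
  open import Relation.Binary.Reasoning.Setoid setoid

  infixr 8 _^_
  _^_ : Carrier → ℕ → Carrier
  x ^ n = n ×ᵐ x

  ^-* : ∀ x m n → (x ^ m) ^ n ≈ x ^ (m * n)
  ^-* x m n = trans (×-assocˡ x n m) (×-congˡ (ℕ.*-comm n m))

  ^-swap : ∀ x m n → (x ^ m) ^ n ≈ (x ^ n) ^ m
  ^-swap x m n = trans (^-* x m n) (trans (×-congˡ (ℕ.*-comm m n)) (sym (^-* x n m)))

  ε^ : ∀ n → ε ^ n ≈ ε
  ε^ zero = refl
  ε^ (suc n) = trans (identityˡ _) (ε^ n)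

  -- Finite order and minimality in one equivalence. The value n = 0 means infinite order, hence the
  -- separate assumptions 0 < n below.
  HasOrder : Carrier → ℕ → Set _
  HasOrder x n = ∀ k → x ^ k ≈ ε ⇔ n ∣ k

  HasOrder-resp : ∀ {x y n} → x ≈ y → HasOrder x n → HasOrder y n
  HasOrder-resp x≈y o k = mk⇔ (λ e → to (o k) (trans (^-cong k x≈y) e))
                              (λ n∣k → trans (^-cong k (sym x≈y)) (from (o k) n∣k))

  ^order : ∀ {x n} → HasOrder x n → x ^ n ≈ ε
  ^order o = from (o _) ∣-refl

  ^-multiple : ∀ {x n k} → x ^ n ≈ ε → n ∣ k → x ^ k ≈ ε
  ^-multiple {x} {n} xⁿ (divides c ≡.refl) = begin
    x ^ (c * n)   ≈⟨ ^-* x c n ⟨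
    (x ^ c) ^ n   ≈⟨ ^-swap x c n ⟩
    (x ^ n) ^ c   ≈⟨ ^-cong c xⁿ ⟩
    ε ^ c         ≈⟨ ε^ c ⟩
    ε             ∎

  -- x ^ (k % n) agrees with x ^ k because the complementary factor is trivial, so a nonzero
  -- remainder would be a positive exponent below the least one.
  least⇒HasOrder : ∀ {x n} → 0 < n → x ^ n ≈ ε → (∀ m → 0 < m → m < n → ¬ x ^ m ≈ ε) → HasOrder x n
  least⇒HasOrder {x} {n} 0<n xⁿ least k = mk⇔ fwd (^-multiple xⁿ)
    where
    instance _ = >-nonZero 0<n
    rem : x ^ k ≈ ε → x ^ (k % n) ≈ ε
    rem xᵏ = begin
      x ^ (k % n)                       ≈⟨ identityʳ _ ⟨
      x ^ (k % n) ∙ ε                   ≈⟨ ∙-congˡ (^-multiple xⁿ (n∣m*n (k / n))) ⟨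
      x ^ (k % n) ∙ x ^ (k / n * n)     ≈⟨ ^-+ x (k % n) _ ⟨
      x ^ (k % n + k / n * n)           ≈⟨ ×-congˡ (m≡m%n+[m/n]*n k n) ⟨
      x ^ k                             ≈⟨ xᵏ ⟩
      ε                                 ∎
    fwd : x ^ k ≈ ε → n ∣ k
    fwd xᵏ with k % n in eq
    ... | zero  = m%n≡0⇒n∣m k n eq
    ... | suc j = ⊥-elim (least (suc j) z<s (subst (_< n) eq (m%n<n k n))
                           (subst (λ i → x ^ i ≈ ε) eq (rem xᵏ)))

  -- Descent to the least positive exponent; `dec` turns the search below k into a bounded,
  -- decidable one.
  HasOrder-exists : ∀ {x} → (∀ k → Dec (x ^ k ≈ ε)) → ∀ k → 0 < k → x ^ k ≈ ε →
                    ∃[ n ] (0 < n × HasOrder x n)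
  HasOrder-exists {x} dec = <-rec _ step
    where
    step : ∀ k → (∀ {m} → m < k → 0 < m → x ^ m ≈ ε → ∃[ n ] (0 < n × HasOrder x n)) →
           0 < k → x ^ k ≈ ε → ∃[ n ] (0 < n × HasOrder x n)
    step k rec 0<k xᵏ with ℕ.anyUpTo? (λ m → (0 ℕ.<? m) ×-dec dec m) k
    ... | yes (m , m<k , 0<m , xᵐ) = rec m<k 0<m xᵐ
    ... | no none = k , 0<k , least⇒HasOrder 0<k xᵏ (λ m 0<m m<k xᵐ → none (m , m<k , 0<m , xᵐ))

  HasOrder-^ : ∀ {x} m n .{{_ : NonZero m}} → HasOrder x (m * n) → HasOrder (x ^ m) n
  HasOrder-^ {x} m n o k = mk⇔
    (λ e → *-cancelˡ-∣ m (to (o (m * k)) (trans (sym (^-* x m k)) e)))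
    (λ n∣k → trans (^-* x m k) (from (o (m * k)) (*-monoʳ-∣ m n∣k)))

  -- Raising (x ∙ y) ^ k ≈ ε to the n-th power removes y and gives m ∣ k n, hence m ∣ k by
  -- coprimality; the m-th power gives n ∣ k in the same way.
  HasOrder-∙ : ∀ {x y m n} → Coprime m n → HasOrder x m → HasOrder y n → HasOrder (x ∙ y) (m * n)
  HasOrder-∙ {x} {y} {m} {n} m⊥n ox oy k = mk⇔ fwd bwd
    where
    [xy]^ : ∀ j → (x ∙ y) ^ j ≈ x ^ j ∙ y ^ j
    [xy]^ = ×-distrib-+ x y
    kill : ∀ j → (x ∙ y) ^ k ≈ ε → x ^ (k * j) ∙ y ^ (k * j) ≈ ε
    kill j e = begin
      x ^ (k * j) ∙ y ^ (k * j)  ≈⟨ [xy]^ (k * j) ⟨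
      (x ∙ y) ^ (k * j)          ≈⟨ ^-multiple {x ∙ y} {k} e (m∣m*n j) ⟩
      ε                          ∎
    fwd : (x ∙ y) ^ k ≈ ε → m * n ∣ k
    fwd e = coprime-∣* m⊥n
      (coprime-divisor m⊥n (subst (m ∣_) (ℕ.*-comm k n) (to (ox (k * n)) (begin
        x ^ (k * n)                ≈⟨ identityʳ _ ⟨
        x ^ (k * n) ∙ ε            ≈⟨ ∙-congˡ (from (oy _) (n∣m*n k)) ⟨
        x ^ (k * n) ∙ y ^ (k * n)  ≈⟨ kill n e ⟩
        ε                          ∎))))
      (coprime-divisor (coprime-sym m⊥n) (subst (n ∣_) (ℕ.*-comm k m) (to (oy (k * m)) (begin
        y ^ (k * m)                ≈⟨ identityˡ _ ⟨
        ε ∙ y ^ (k * m)            ≈⟨ ∙-congʳ (from (ox _) (n∣m*n k)) ⟨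
        x ^ (k * m) ∙ y ^ (k * m)  ≈⟨ kill m e ⟩
        ε                          ∎))))
    bwd : m * n ∣ k → (x ∙ y) ^ k ≈ ε
    bwd mn∣k = begin
      (x ∙ y) ^ k    ≈⟨ [xy]^ k ⟩
      x ^ k ∙ y ^ k  ≈⟨ ∙-cong (from (ox k) (∣-trans (m∣m*n n) mn∣k)) (from (oy k) (∣-trans (n∣m*n m) mn∣k)) ⟩
      ε ∙ ε          ≈⟨ identityˡ ε ⟩
      ε              ∎

  -- If q is a prime dividing m / gcd(m,n) and qᵇ is the exact power of q in gcd(m,n),
  -- then qᵇ is also the exact power of q in n, while qᵇ⁺¹ divides m.
  HasOrder-increase : ∀ {x y m n} → 0 < m → 0 < n → HasOrder x m → HasOrder y n → ¬ m ∣ n →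
                      ∃[ i ] ∃[ j ] ∃[ n′ ] (n < n′ × HasOrder (x ^ i ∙ y ^ j) n′)
  HasOrder-increase {x} {y} {m} {n} 0<m 0<n ox oy m∤n
    with gcd m n | gcd-greatest {m} {n} | gcd[m,n]∣m m n | gcd[m,n]∣n m n
  ... | d | greatest | divides m′ ≡.refl | divides n′ ≡.refl = result
    where
    instance
      m′d≢0 : NonZero (m′ * d)
      m′d≢0 = >-nonZero 0<m
      m′≢0 : NonZero m′
      m′≢0 = ℕ.m*n≢0⇒m≢0 m′
      d≢0 : NonZero d
      d≢0 = ℕ.m*n≢0⇒n≢0 m′
    coprime : Coprime m′ n′
    coprime {e} (e∣m′ , e∣n′) = ∣1⇒≡1 (*-cancelʳ-∣ d (subst (e * d ∣_) (≡.sym (ℕ.*-identityˡ d))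
      (greatest (*-monoˡ-∣ d e∣m′) (*-monoˡ-∣ d e∣n′))))
    1<m′ : 1 < m′
    1<m′ = ℕ.≤∧≢⇒< (>-nonZero⁻¹ m′) λ { ≡.refl → m∤n (subst (_∣ n′ * d) (≡.sym (ℕ.*-identityˡ d)) (n∣m*n n′)) }
    result : ∃[ i ] ∃[ j ] ∃[ k ] (n′ * d < k × HasOrder (x ^ i ∙ y ^ j) k)
    result with prime-divisor m′ 1<m′
    ... | q , pq , q∣m′ with q∣m′ | remove-prime pq d
    ...   | divides c ≡.refl | b , d₁ , d≡ , q∤d₁ =
      -- Here m = c d₁ · qᵇ⁺¹ and n = qᵇ · n′ d₁. These exponents cut the orders down to the coprime
      -- numbers qᵇ⁺¹ and n′ d₁, whose product is q n.
      c * d₁ , q ^ℕ b , q ^ℕ suc b * (n′ * d₁) , bigger ,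
      HasOrder-∙ (prime^-coprime pq q∤n₁ (suc b))
        (HasOrder-^ (c * d₁) (q ^ℕ suc b) (subst (HasOrder x) m≡ ox))
        (HasOrder-^ (q ^ℕ b) (n′ * d₁) (subst (HasOrder y) n≡ oy))
      where
      open +-*-Solver
      q∤n₁ : ¬ q ∣ n′ * d₁
      q∤n₁ q∣n₁ with euclidsLemma n′ d₁ pq q∣n₁
      ... | inj₂ q∣d₁ = q∤d₁ q∣d₁
      ... | inj₁ q∣n′ = ℕ.<-irrefl (≡.sym (coprime (q∣m′ , q∣n′))) (nonTrivial⇒n>1 q {{prime⇒nonTrivial pq}})
      m≡ : c * q * d ≡ c * d₁ * q ^ℕ suc b
      m≡ = ≡.trans (cong (c * q *_) d≡)
        (solve 4 (λ c q Q d → c :* q :* (Q :* d) := c :* d :* (q :* Q)) ≡.refl c q (q ^ℕ b) d₁)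
      n≡ : n′ * d ≡ q ^ℕ b * (n′ * d₁)
      n≡ = ≡.trans (cong (n′ *_) d≡)
        (solve 3 (λ n Q d → n :* (Q :* d) := Q :* (n :* d)) ≡.refl n′ (q ^ℕ b) d₁)
      instance
        cd₁≢0 : NonZero (c * d₁)
        cd₁≢0 = ℕ.m*n≢0⇒m≢0 (c * d₁) {{subst NonZero m≡ m′d≢0}}
        qᵇ≢0 : NonZero (q ^ℕ b)
        qᵇ≢0 = ℕ.m*n≢0⇒m≢0 (q ^ℕ b) {{subst NonZero n≡ (>-nonZero 0<n)}}
        n≢0 : NonZero (n′ * d)
        n≢0 = >-nonZero 0<n
      bigger : n′ * d < q ^ℕ suc b * (n′ * d₁)
      bigger = subst (n′ * d <_)
        (≡.trans (cong (_* q) n≡)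
          (solve 3 (λ q Q n → Q :* n :* q := q :* Q :* n) ≡.refl q (q ^ℕ b) (n′ * d₁)))
        (ℕ.m<m*n (n′ * d) q (nonTrivial⇒n>1 q {{prime⇒nonTrivial pq}}))

  -- Cancels x ^ a without inverses: multiples of n are trivial exponents, so a n - a acts as -a.
  ^-eq⇒ : ∀ {x n} → 0 < n → HasOrder x n → ∀ a b → x ^ (a + b) ≈ x ^ a → n ∣ b
  ^-eq⇒ {x} {n} 0<n o a b e = to (o b) (begin
    x ^ b                                ≈⟨ identityˡ _ ⟨
    ε ∙ x ^ b                            ≈⟨ ∙-congʳ cancel ⟨
    (x ^ c ∙ x ^ a) ∙ x ^ b              ≈⟨ assoc _ _ _ ⟩
    x ^ c ∙ (x ^ a ∙ x ^ b)              ≈⟨ ∙-congˡ (^-+ x a b) ⟨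
    x ^ c ∙ x ^ (a + b)                  ≈⟨ ∙-congˡ e ⟩
    x ^ c ∙ x ^ a                        ≈⟨ cancel ⟩
    ε                                    ∎)
    where
    c : ℕ
    c = a * n ∸ a
    cancel : x ^ c ∙ x ^ a ≈ ε
    cancel = begin
      x ^ c ∙ x ^ a  ≈⟨ ^-+ x c a ⟨
      x ^ (c + a)    ≈⟨ ×-congˡ (ℕ.m∸n+n≡m (ℕ.m≤m*n a n {{>-nonZero 0<n}})) ⟩
      x ^ (a * n)    ≈⟨ from (o _) (n∣m*n a) ⟩
      ε              ∎

  HasOrder-^⇒∣ : ∀ {x N r} s → HasOrder x N → HasOrder (x ^ s) r → r ∣ N
  HasOrder-^⇒∣ {x} {N} s ox oh = to (oh N) (trans (^-swap x s N) (trans (^-cong s (^order ox)) (ε^ s)))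

  -- ⇐ is Bézout's identity, because gcd(s , d r) divides d.
  ^∈⟨^⟩⇔ : ∀ {x} d r s .{{_ : NonZero r}} → HasOrder x (d * r) → HasOrder (x ^ s) r →
           ∀ k → (∃[ j ] x ^ k ≈ (x ^ s) ^ j) ⇔ d ∣ k
  ^∈⟨^⟩⇔ {x} d r s ox oh k = mk⇔ fwd bwd
    where
    h : Carrier
    h = x ^ s
    fwd : (∃[ j ] x ^ k ≈ h ^ j) → d ∣ k
    fwd (j , e) = *-cancelʳ-∣ r (to (ox (k * r)) (begin
      x ^ (k * r)  ≈⟨ ^-* x k r ⟨
      (x ^ k) ^ r  ≈⟨ ^-cong r e ⟩
      (h ^ j) ^ r  ≈⟨ ^-* h j r ⟩
      h ^ (j * r)  ≈⟨ from (oh _) (n∣m*n j) ⟩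
      ε            ∎))
    G : ℕ
    G = gcd s (d * r)
    -- Write d r = N′ G. Since d r divides s N′, the power h ^ N′ is trivial; so r ∣ N′, and
    -- cancelling r shows that G divides d.
    G∣d : G ∣ d
    G∣d with gcd[m,n]∣m s (d * r) | gcd[m,n]∣n s (d * r)
    ... | divides s′ s≡ | divides N′ N≡
      with to (oh N′) (trans (^-* x s N′) (from (ox _) (divides s′
             (≡.trans (cong (_* N′) s≡) (≡.trans (ℕ.*-assoc s′ G N′) (cong (s′ *_) (≡.trans (ℕ.*-comm G N′) (≡.sym N≡))))))))
    ...   | divides c ≡.refl = divides c (ℕ.*-cancelʳ-≡ d (c * G) r (≡.trans N≡ (*-swap c r G)))
      where
      *-swap : ∀ a b e → a * b * e ≡ a * e * b
      *-swap a b e = ≡.trans (ℕ.*-assoc a b e) (≡.trans (cong (a *_) (ℕ.*-comm b e)) (≡.sym (ℕ.*-assoc a e b)))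
    xᴳ : ∃[ j ] x ^ G ≈ h ^ j
    xᴳ with Bézout.identity (gcd-GCD s (d * r))
    ... | Bézout.+- a b eq = a , (begin
      x ^ G                          ≈⟨ identityʳ _ ⟨
      x ^ G ∙ ε                      ≈⟨ ∙-congˡ (from (ox _) (n∣m*n b)) ⟨
      x ^ G ∙ x ^ (b * (d * r))      ≈⟨ ^-+ x G _ ⟨
      x ^ (G + b * (d * r))          ≈⟨ ×-congˡ (≡.trans eq (ℕ.*-comm a s)) ⟩
      x ^ (s * a)                    ≈⟨ ^-* x s a ⟨
      h ^ a                          ∎)
    -- Here G + a s = b d r, so x ^ G is inverse to h ^ a, and a r - a serves as the exponent -a
    -- because h has order r.
    ... | Bézout.-+ a b eq = a * r ∸ a , (begin
      x ^ G                                    ≈⟨ identityʳ _ ⟨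
      x ^ G ∙ ε                                ≈⟨ ∙-congˡ hᵃʳ ⟨
      x ^ G ∙ (h ^ a ∙ h ^ (a * r ∸ a))        ≈⟨ assoc _ _ _ ⟨
      (x ^ G ∙ h ^ a) ∙ h ^ (a * r ∸ a)        ≈⟨ ∙-congʳ (begin
        x ^ G ∙ h ^ a          ≈⟨ ∙-congˡ (trans (^-* x s a) (×-congˡ (ℕ.*-comm s a))) ⟩
        x ^ G ∙ x ^ (a * s)    ≈⟨ ^-+ x G _ ⟨
        x ^ (G + a * s)        ≈⟨ ×-congˡ eq ⟩
        x ^ (b * (d * r))      ≈⟨ from (ox _) (n∣m*n b) ⟩
        ε                      ∎) ⟩
      ε ∙ h ^ (a * r ∸ a)                      ≈⟨ identityˡ _ ⟩
      h ^ (a * r ∸ a)                          ∎)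
      where
      hᵃʳ : h ^ a ∙ h ^ (a * r ∸ a) ≈ ε
      hᵃʳ = begin
        h ^ a ∙ h ^ (a * r ∸ a)  ≈⟨ ^-+ h a _ ⟨
        h ^ (a + (a * r ∸ a))    ≈⟨ ×-congˡ (ℕ.m+[n∸m]≡n (ℕ.m≤m*n a r)) ⟩
        h ^ (a * r)              ≈⟨ from (oh _) (n∣m*n a) ⟩
        ε                        ∎
    bwd : d ∣ k → ∃[ j ] x ^ k ≈ h ^ j
    bwd d∣k with ∣-trans G∣d d∣k | xᴳ
    ... | divides c ≡.refl | j , e = j * c , (begin
      x ^ (c * G)  ≈⟨ ×-congˡ (ℕ.*-comm c G) ⟩
      x ^ (G * c)  ≈⟨ ^-* x G c ⟨
      (x ^ G) ^ c  ≈⟨ ^-cong c e ⟩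
      (h ^ j) ^ c  ≈⟨ ^-* h j c ⟩
      h ^ (j * c)  ∎)

  ^-injective : ∀ {x n i j} → 0 < n → HasOrder x n → i < n → j < n → x ^ i ≈ x ^ j → i ≡ j
  ^-injective {x} {n} {i} {j} 0<n o i<n j<n e =
    [ (λ i≤j → close j<n i≤j (sym e)) , (λ j≤i → ≡.sym (close i<n j≤i e)) ]′ (ℕ.≤-total i j)
    where
    close : ∀ {i j} → j < n → i ≤ j → x ^ j ≈ x ^ i → i ≡ j
    close {i} {j} j<n i≤j e
      with j ∸ i in eq | ^-eq⇒ 0<n o i (j ∸ i) (trans (×-congˡ (ℕ.m+[n∸m]≡n i≤j)) e)
    ... | zero  | _  = ℕ.≤-antisym i≤j (ℕ.m∸n≡0⇒m≤n eq)
    ... | suc _ | n∣ = ⊥-elim (ℕ.<⇒≱ (ℕ.≤-<-trans (ℕ.m∸n≤m j i) j<n) (subst (n ≤_) (≡.sym eq) (∣⇒≤ n∣)))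

-- Cyclicity of the unit group of a finite domain.

record FiniteDomain {c ℓ} (R : CommutativeRing c ℓ) : Set (c ⊔ ℓ) where
  open CommutativeRing R
  field
    _≟_            : Decidable _≈_
    noZeroDivisors : ∀ x y → x * y ≈ 0# → x ≈ 0# ⊎ y ≈ 0#
    1≉0            : ¬ 1# ≈ 0#
    {size}         : ℕ
    -- Repetitions are allowed: surjectivity alone supports the pigeonhole principle, the bound on
    -- orders and exhaustive search.
    rep            : Fin size → Carrier
    rep-surjective : ∀ x → ∃[ i ] rep i ≈ x

module UnitsOfFiniteDomain {c ℓ} {R : CommutativeRing c ℓ} (D : FiniteDomain R) where
  open CommutativeRing R
  open FiniteDomain D renaming (size to N)
  open Orders *-commutativeMonoid
  open import Algebra.Properties.CommutativeMonoid.Mult *-commutativeMonoid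
    using () renaming (×-congʳ to ^-cong; ×-congˡ to ^-≡; ×-homo-+ to ^-+)
  open import Algebra.Solver.Ring.NaturalCoefficients.Default commutativeSemiring
  open import Relation.Binary.Reasoning.Setoid setoid

  ≉0-* : ∀ {x y} → ¬ x ≈ 0# → ¬ y ≈ 0# → ¬ x * y ≈ 0#
  ≉0-* x≉0 y≉0 xy≈0 = [ x≉0 , y≉0 ]′ (noZeroDivisors _ _ xy≈0)

  ≉0-^ : ∀ {x} → ¬ x ≈ 0# → ∀ k → ¬ x ^ k ≈ 0#
  ≉0-^ x≉0 zero    = 1≉0
  ≉0-^ x≉0 (suc k) = ≉0-* x≉0 (≉0-^ x≉0 k)

  x-y+y≈x : ∀ x y → (x - y) + y ≈ x
  x-y+y≈x x y = trans (+-assoc x (- y) y) (trans (+-congˡ (-‿inverseˡ y)) (+-identityʳ x))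

  x-y≈0⇒x≈y : ∀ x y → x - y ≈ 0# → x ≈ y
  x-y≈0⇒x≈y x y e = trans (sym (x-y+y≈x x y)) (trans (+-congʳ e) (+-identityˡ y))

  *-cancelˡ : ∀ {x y z} → ¬ x ≈ 0# → x * y ≈ x * z → y ≈ z
  *-cancelˡ {x} {y} {z} x≉0 e with noZeroDivisors x (y - z) zero-product
    where
    zero-product : x * (y - z) ≈ 0#
    zero-product = begin
      x * (y - z)                     ≈⟨ +-identityʳ _ ⟨
      x * (y - z) + 0#                ≈⟨ +-congˡ (-‿inverseʳ (x * z)) ⟨
      x * (y - z) + (x * z - x * z)   ≈⟨ +-assoc _ _ _ ⟨
      x * (y - z) + x * z - x * z     ≈⟨ +-congʳ (distribˡ x _ z) ⟨
      x * (y - z + z) - x * z         ≈⟨ +-congʳ (*-congˡ (x-y+y≈x y z)) ⟩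
      x * y - x * z                   ≈⟨ +-congʳ e ⟩
      x * z - x * z                   ≈⟨ -‿inverseʳ _ ⟩
      0#                              ∎
  ... | inj₁ x≈0   = ⊥-elim (x≉0 x≈0)
  ... | inj₂ y-z≈0 = x-y≈0⇒x≈y y z y-z≈0

  index : Carrier → Fin N
  index x = proj₁ (rep-surjective x)

  index-injective : ∀ {x y} → index x ≡ index y → x ≈ y
  index-injective {x} {y} e = begin
    x              ≈⟨ proj₂ (rep-surjective x) ⟨
    rep (index x)  ≡⟨ cong rep e ⟩
    rep (index y)  ≈⟨ proj₂ (rep-surjective y) ⟩
    y              ∎

  -- Among the first N + 1 powers two coincide, and the one with the smaller exponent is cancelled.
  ≉0⇒^≈1 : ∀ {x} → ¬ x ≈ 0# → ∃[ k ] (0 < k × x ^ k ≈ 1#)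
  ≉0⇒^≈1 {x} x≉0 with Fin.pigeonhole (ℕ.n<1+n N) (λ i → index (x ^ toℕ i))
  ... | i , j , i<j , e = toℕ j ∸ toℕ i , ℕ.m<n⇒0<n∸m i<j , sym (*-cancelˡ (≉0-^ x≉0 (toℕ i)) (begin
    x ^ toℕ i * 1#                       ≈⟨ *-identityʳ _ ⟩
    x ^ toℕ i                            ≈⟨ index-injective e ⟩
    x ^ toℕ j                            ≈⟨ ^-≡ (ℕ.m+[n∸m]≡n (ℕ.<⇒≤ i<j)) ⟨
    x ^ (toℕ i ℕ.+ (toℕ j ∸ toℕ i))      ≈⟨ ^-+ x (toℕ i) _ ⟩
    x ^ toℕ i * x ^ (toℕ j ∸ toℕ i)      ∎))

  order : ∀ {x} → ¬ x ≈ 0# → ∃[ n ] (0 < n × HasOrder x n)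
  order x≉0 with ≉0⇒^≈1 x≉0
  ... | k , 0<k , xᵏ = HasOrder-exists (λ j → (_ ^ j) ≟ 1#) k 0<k xᵏ

  order≤ : ∀ {x n} → 0 < n → HasOrder x n → n ≤ N
  order≤ {x} {n} 0<n o = Fin.injective⇒≤ {f = λ i → index (x ^ toℕ i)}
    λ e → Fin.toℕ-injective (^-injective 0<n o (Fin.toℕ<n _) (Fin.toℕ<n _) (index-injective e))

  -- Monic polynomial functions of degree d, described by iterated divided differences.
  Monic : ℕ → (Carrier → Carrier) → Set (c ⊔ ℓ)
  Monic zero    f = ∀ x → f x ≈ 1#
  Monic (suc d) f = ∀ c → ∃[ q ] (Monic d q × ∀ x → f x ≈ (x - c) * q x + f c)

  -- Splitting off the root `xs fzero` leaves a quotient of lower degree; it vanishes at every other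
  -- root, as the factor x - c is nonzero there. The process ends at the constant 1, which has no
  -- root.
  Monic-roots : ∀ d {f} → Monic d f → (xs : Fin (suc d) → Carrier) →
                (∀ i j → xs i ≈ xs j → i ≡ j) → ¬ (∀ i → f (xs i) ≈ 0#)
  Monic-roots zero    mon xs inj roots = 1≉0 (trans (sym (mon (xs fzero))) (roots fzero))
  Monic-roots (suc d) {f} mon xs inj roots with mon (xs fzero)
  ... | q , mon-q , f≈ = Monic-roots d mon-q (λ i → xs (fsuc i))
      (λ i j e → Fin.suc-injective (inj _ _ e)) root-q
    where
    root-q : ∀ i → q (xs (fsuc i)) ≈ 0#
    root-q i with noZeroDivisors (xs (fsuc i) - xs fzero) (q (xs (fsuc i))) (begin
        (xs (fsuc i) - xs fzero) * q (xs (fsuc i))                   ≈⟨ +-identityʳ _ ⟨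
        (xs (fsuc i) - xs fzero) * q (xs (fsuc i)) + 0#              ≈⟨ +-congˡ (roots fzero) ⟨
        (xs (fsuc i) - xs fzero) * q (xs (fsuc i)) + f (xs fzero)    ≈⟨ f≈ _ ⟨
        f (xs (fsuc i))                                              ≈⟨ roots (fsuc i) ⟩
        0#                                                           ∎)
    ... | inj₂ e = e
    ... | inj₁ e with inj (fsuc i) fzero (x-y≈0⇒x≈y _ _ e)
    ...   | ()

  -- A summand of lower degree leaves the leading coefficient alone. The case needed is xⁿ + c q(x),
  -- the divided difference of xⁿ⁺¹ at c when q is that of xⁿ.
  Monic-+* : ∀ d {f g} → Monic (suc d) f → Monic d g → ∀ k → Monic (suc d) (λ x → f x + k * g x)
  Monic-+* zero {f} {g} mf mg k c with mf c
  ... | q , mq , f≈ = q , mq , λ x → begin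
    f x + k * g x                  ≈⟨ +-cong (f≈ x) (*-congˡ (trans (mg x) (sym (mg c)))) ⟩
    ((x - c) * q x + f c) + k * g c ≈⟨ +-assoc _ _ _ ⟩
    (x - c) * q x + (f c + k * g c) ∎
  Monic-+* (suc d) {f} {g} mf mg k c with mf c | mg c
  ... | q , mq , f≈ | q′ , mq′ , g≈ = (λ x → q x + k * q′ x) , Monic-+* d mq mq′ k , λ x → begin
    f x + k * g x                                            ≈⟨ +-cong (f≈ x) (*-congˡ (g≈ x)) ⟩
    ((x - c) * q x + f c) + k * ((x - c) * q′ x + g c)       ≈⟨ solve 6 (λ y q a k q′ b →
       ((y :* q :+ a) :+ k :* (y :* q′ :+ b)) := (y :* (q :+ k :* q′) :+ (a :+ k :* b))) refl (x - c) (q x) (f c) k (q′ x) (g c) ⟩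
    (x - c) * (q x + k * q′ x) + (f c + k * g c)             ∎

  Monic-^ : ∀ n → Monic n (_^ n)
  Monic-^ zero x = refl
  -- Degree 1 stands apart because `Monic zero` offers no quotient to recur on.
  Monic-^ (suc zero) c = (λ _ → 1#) , (λ _ → refl) , λ x → begin
    x * 1#                    ≈⟨ *-congʳ (x-y+y≈x x c) ⟨
    (x - c + c) * 1#          ≈⟨ distribʳ 1# _ _ ⟩
    (x - c) * 1# + c * 1#     ∎
  Monic-^ (suc n@(suc d)) c = let q , mq , e = Monic-^ n c in
    (λ x → x ^ n + c * q x) , Monic-+* d (Monic-^ n) mq c , λ x → begin
    x * x ^ n                                        ≈⟨ *-congʳ (x-y+y≈x x c) ⟨
    (x - c + c) * x ^ n                              ≈⟨ distribʳ _ _ _ ⟩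
    (x - c) * x ^ n + c * x ^ n                      ≈⟨ +-congˡ (*-congˡ (e x)) ⟩
    (x - c) * x ^ n + c * ((x - c) * q x + c ^ n)    ≈⟨ solve 5 (λ y X c q C →
       (y :* X :+ c :* (y :* q :+ C)) := (y :* (X :+ c :* q) :+ c :* C)) refl (x - c) (x ^ n) c (q x) (c ^ n) ⟩
    (x - c) * (x ^ n + c * q x) + c * c ^ n          ∎

  -- Otherwise x and the n distinct powers of g with exponent below n would be n + 1 roots of the
  -- monic function yⁿ - 1.
  roots-of-unity : ∀ {g n} → 0 < n → HasOrder g n → ∀ x → x ^ n ≈ 1# → ∃[ i ] g ^ i ≈ x
  roots-of-unity {g} {n@(suc d)} 0<n o x xⁿ with Fin.any? (λ (i : Fin n) → (g ^ toℕ i) ≟ x)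
  ... | yes (i , e) = toℕ i , e
  ... | no x∉⟨g⟩ = ⊥-elim (Monic-roots n shifted xs distinct roots)
    where
    -- Subtracting 1 changes only the value at c; the divided differences are those of yⁿ.
    shifted : Monic n (λ y → y ^ n + - 1#)
    shifted c with Monic-^ n c
    ... | q , mq , e = q , mq , λ y → trans (+-congʳ (e y)) (+-assoc _ _ _)
    xs : Fin (suc n) → Carrier
    xs fzero    = x
    xs (fsuc i) = g ^ toℕ i
    distinct : ∀ i j → xs i ≈ xs j → i ≡ j
    distinct fzero    fzero    e = ≡.refl
    distinct fzero    (fsuc j) e = ⊥-elim (x∉⟨g⟩ (j , sym e))
    distinct (fsuc i) fzero    e = ⊥-elim (x∉⟨g⟩ (i , e))
    distinct (fsuc i) (fsuc j) e =
      cong fsuc (Fin.toℕ-injective (^-injective 0<n o (Fin.toℕ<n i) (Fin.toℕ<n j) e))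
    root : ∀ y → y ^ n ≈ 1# → y ^ n + - 1# ≈ 0#
    root y e = trans (+-congʳ e) (-‿inverseʳ 1#)
    roots : ∀ i → xs i ^ n + - 1# ≈ 0#
    roots fzero    = root x xⁿ
    roots (fsuc i) = root _ (trans (^-swap g (toℕ i) n) (trans (^-cong (toℕ i) (^order o)) (ε^ (toℕ i))))

  Exponent : Set _
  Exponent = ∃[ g ] ∃[ n ] (¬ g ≈ 0# × 0 < n × HasOrder g n × (∀ x → ¬ x ≈ 0# → x ^ n ≈ 1#))

  -- While some unit fails xⁿ = 1, its order does not divide n and `HasOrder-increase` yields a unit
  -- of larger order. Orders never exceed N, so `N < n + fuel` makes exhausted fuel contradictory.
  exponent : ∀ fuel {g n} → ¬ g ≈ 0# → 0 < n → HasOrder g n → N < n ℕ.+ fuel → Exponent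
  exponent zero g≉0 0<n o N<n =
    ⊥-elim (ℕ.<⇒≱ (subst (N <_) (ℕ.+-identityʳ _) N<n) (order≤ 0<n o))
  exponent (suc fuel) {g} {n} g≉0 0<n o N<
    with Fin.any? (λ i → ¬? (rep i ≟ 0#) ×-dec ¬? ((rep i ^ n) ≟ 1#))
  ... | no none = g , n , g≉0 , 0<n , o , all
    where
    all : ∀ x → ¬ x ≈ 0# → x ^ n ≈ 1#
    all x x≉0 with rep-surjective x
    ... | i , e with (rep i ^ n) ≟ 1#
    ...   | yes e′ = trans (^-cong n (sym e)) e′
    ...   | no ¬e′ = ⊥-elim (none (i , (λ z → x≉0 (trans (sym e) z)) , ¬e′))
  ... | yes (i , i≉0 , ¬e) with order i≉0
  ...   | m , 0<m , oᵢ with HasOrder-increase 0<m 0<n oᵢ o (λ m∣n → ¬e (from (oᵢ n) m∣n))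
  ...     | a , b , n′ , n<n′ , o′ = exponent fuel (≉0-* (≉0-^ i≉0 a) (≉0-^ g≉0 b))
              (ℕ.<-trans 0<n n<n′) o′ (ℕ.<-≤-trans N< (subst (ℕ._≤ n′ ℕ.+ fuel) (≡.sym (ℕ.+-suc n fuel)) (ℕ.+-monoˡ-≤ fuel n<n′)))

  cyclic : ∃[ g ] (¬ g ≈ 0# × ∀ x → ¬ x ≈ 0# → ∃[ i ] g ^ i ≈ x)
  cyclic with order 1≉0
  ... | n , 0<n , o with exponent (suc N) 1≉0 0<n o (ℕ.≤-trans (ℕ.n<1+n N) (ℕ.m≤n+m (suc N) n))
  ...   | g , n′ , g≉0 , 0<n′ , o′ , all = g , g≉0 , λ x x≉0 → roots-of-unity 0<n′ o′ x (all x x≉0)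

-- Congruences of integers modulo n.

open import Data.Integer.Base as ℤ using (ℤ; +_; 0ℤ; 1ℤ; _+_; _-_; _*_; -_; ∣_∣)
import Data.Integer.Properties as ℤ
open import Data.Integer.Divisibility using (_∣_)
import Data.Integer.Divisibility.Signed as Signed
open import Data.Integer.DivMod using (_%ℕ_; _/ℕ_; a≡a%ℕn+[a/ℕn]*n; n%ℕd<d)
open import Data.Integer.Tactic.RingSolver using (solve-∀)

module Modulo (n : ℕ) where

  -- A record, so that the two sides can be inferred from a proof.
  infix 4 _≋_
  record _≋_ (a b : ℤ) : Set where
    constructor mk
    field un : a ≡[ n ] b
  open _≋_ public

  ≋-intro : ∀ {a b} q → a ≡ b + q * + n → a ≋ b
  ≋-intro {a} {b} q e = mk (Signed.∣⇒∣ᵤ (Signed.divides q (≡.trans (cong (_- b) e) (lemma b (q * + n)))))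
    where
    lemma : ∀ b c → (b + c) - b ≡ c
    lemma = solve-∀

  ≋-elim : ∀ {a b} → a ≋ b → ∃[ q ] a ≡ b + q * + n
  ≋-elim {a} {b} (mk e) with Signed.∣ᵤ⇒∣ e
  ... | Signed.divides q eq = q , ≡.trans (lemma a b) (cong (λ c → b + c) eq)
    where
    lemma : ∀ a b → a ≡ b + (a - b)
    lemma = solve-∀

  ≡⇒≋ : ∀ {a b} → a ≡ b → a ≋ b
  ≡⇒≋ {a} ≡.refl = ≋-intro 0ℤ (≡.sym (ℤ.+-identityʳ a))

  ≋-refl : ∀ {a} → a ≋ a
  ≋-refl = ≡⇒≋ ≡.refl

  ≋-sym : ∀ {a b} → a ≋ b → b ≋ a
  ≋-sym {a} {b} e with ≋-elim e
  ... | q , ≡.refl = ≋-intro (- q) (lemma b q (+ n))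
    where
    lemma : ∀ b q n → b ≡ b + q * n + - q * n
    lemma = solve-∀

  ≋-trans : ∀ {a b c} → a ≋ b → b ≋ c → a ≋ c
  ≋-trans {c = c} e f with ≋-elim f
  ... | r , ≡.refl with ≋-elim e
  ...   | q , ≡.refl = ≋-intro (r + q) (lemma c r q (+ n))
    where
    lemma : ∀ c r q n → c + r * n + q * n ≡ c + (r + q) * n
    lemma = solve-∀

  +-cong : ∀ {a b c d} → a ≋ b → c ≋ d → a + c ≋ b + d
  +-cong {b = b} {d = d} e f with ≋-elim e | ≋-elim f
  ... | q , ≡.refl | r , ≡.refl = ≋-intro (q + r) (lemma b d q r (+ n))
    where
    lemma : ∀ b d q r n → (b + q * n) + (d + r * n) ≡ b + d + (q + r) * n
    lemma = solve-∀

  *-cong : ∀ {a b c d} → a ≋ b → c ≋ d → a * c ≋ b * d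
  *-cong {b = b} {d = d} e f with ≋-elim e | ≋-elim f
  ... | q , ≡.refl | r , ≡.refl = ≋-intro (b * r + q * d + q * r * + n) (lemma b d q r (+ n))
    where
    lemma : ∀ b d q r n → (b + q * n) * (d + r * n) ≡ b * d + (b * r + q * d + q * r * n) * n
    lemma = solve-∀

  -‿cong : ∀ {a b} → a ≋ b → - a ≋ - b
  -‿cong {b = b} e with ≋-elim e
  ... | q , ≡.refl = ≋-intro (- q) (lemma b q (+ n))
    where
    lemma : ∀ b q n → - (b + q * n) ≡ - b + - q * n
    lemma = solve-∀

  sub-cong : ∀ {a b c d} → a ≋ b → c ≋ d → a - c ≋ b - d
  sub-cong e f = +-cong e (-‿cong f)

  ∣⇒≋0 : ∀ {a} → + n ∣ a → a ≋ 0ℤ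
  ∣⇒≋0 {a} d = mk (subst (+ n ∣_) (≡.sym (ℤ.+-identityʳ a)) d)

  ≋0⇒∣ : ∀ {a} → a ≋ 0ℤ → + n ∣ a
  ≋0⇒∣ {a} (mk d) = subst (+ n ∣_) (ℤ.+-identityʳ a) d

  _≋?_ : ∀ a b → Dec (a ≋ b)
  a ≋? b with n ℕ.∣? ∣ a - b ∣
  ... | yes d = yes (mk d)
  ... | no ¬d = no λ { (mk d) → ¬d d }

  ≋-isEquivalence : IsEquivalence _≋_
  ≋-isEquivalence = record { refl = ≋-refl ; sym = ≋-sym ; trans = ≋-trans }

  ℤ/n : CommutativeRing 0ℓ 0ℓ
  ℤ/n = record
    { Carrier = ℤ ; _≈_ = _≋_ ; _+_ = _+_ ; _*_ = _*_ ; -_ = -_ ; 0# = 0ℤ ; 1# = 1ℤ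
    ; isCommutativeRing = record
      { isRing = record
        { +-isAbelianGroup = record
          { isGroup = record
            { isMonoid = record
              { isSemigroup = record
                { isMagma = record { isEquivalence = ≋-isEquivalence ; ∙-cong = +-cong }
                ; assoc = λ a b c → ≡⇒≋ (ℤ.+-assoc a b c) }
              ; identity = (λ a → ≡⇒≋ (ℤ.+-identityˡ a)) , (λ a → ≡⇒≋ (ℤ.+-identityʳ a)) }
            ; inverse = (λ a → ≡⇒≋ (ℤ.+-inverseˡ a)) , (λ a → ≡⇒≋ (ℤ.+-inverseʳ a))
            ; ⁻¹-cong = -‿cong }
          ; comm = λ a b → ≡⇒≋ (ℤ.+-comm a b) }
        ; *-cong = *-cong
        ; *-assoc = λ a b c → ≡⇒≋ (ℤ.*-assoc a b c)
        ; *-identity = (λ a → ≡⇒≋ (ℤ.*-identityˡ a)) , (λ a → ≡⇒≋ (ℤ.*-identityʳ a))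
        ; distrib = (λ a b c → ≡⇒≋ (ℤ.*-distribˡ-+ a b c)) , (λ a b c → ≡⇒≋ (ℤ.*-distribʳ-+ a b c)) }
      ; *-comm = λ a b → ≡⇒≋ (ℤ.*-comm a b) } }

  -- By symmetry it suffices to compare a + c with a for a multiple c of n, so that properties of
  -- congruent naturals reduce to natural addition.
  +≋+⇒ : ∀ {P : ℕ → ℕ → Set} → (∀ {a b} → P a b → P b a) → (∀ a c → n ℕ.∣ c → P (a ℕ.+ c) a) →
         ∀ a b → + a ≋ + b → P a b
  +≋+⇒ {P} P-sym P-step a b (mk d) with ℕ.≤-total a b
  ... | inj₁ a≤b = P-sym (subst (λ c → P c a) (ℕ.m+[n∸m]≡n a≤b)
          (P-step a (b ∸ a) (subst (n ℕ.∣_) (≡.trans (cong ∣_∣ (ℤ.[+m]-[+n]≡m⊖n a b)) (ℤ.∣⊖∣-≤ a≤b)) d)))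
  ... | inj₂ b≤a = subst (λ c → P c b) (ℕ.m+[n∸m]≡n b≤a)
          (P-step b (a ∸ b) (subst (n ℕ.∣_)
            (≡.trans (ℤ.∣i-j∣≡∣j-i∣ (+ a) (+ b)) (≡.trans (cong ∣_∣ (ℤ.[+m]-[+n]≡m⊖n b a)) (ℤ.∣⊖∣-≤ b≤a))) d))

  module _ .{{_ : NonZero n}} where
    %≋ : ∀ a → a ≋ + (a %ℕ n)
    %≋ a = ≋-intro (a /ℕ n) (a≡a%ℕn+[a/ℕn]*n a n)

    residue-unique : ∀ {a b} → a < n → b < n → + a ≋ + b → a ≡ b
    residue-unique {a} {b} a<n b<n e =
      +≋+⇒ {λ a b → a < n → b < n → a ≡ b} (λ f b<n a<n → ≡.sym (f a<n b<n)) step a b e a<n b<n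
      where
      step : ∀ a c → n ℕ.∣ c → a ℕ.+ c < n → a < n → a ℕ.+ c ≡ a
      step a zero    _   _ _ = ℕ.+-identityʳ a
      step a (suc c) n∣c l _ = ⊥-elim (ℕ.<⇒≱ (ℕ.≤-<-trans (ℕ.m≤n+m (suc c) a) l) (ℕ.∣⇒≤ n∣c))

-- Target groups, generators and cyclic quotients.

-- The carriers keep elements that are not valid, such as 0 modulo p, so only a commutative monoid
-- is required; validity marks the elements of the group proper.
record Laws (T : TGrp) : Set where
  open TGrp T
  field
    isCommutativeMonoid : IsCommutativeMonoid _≈_ _·_ e
    e-valid : Valid e
    ·-valid : ∀ {x y} → Valid x → Valid y → Valid (x · y)

  commutativeMonoid : CommutativeMonoid 0ℓ 0ℓ
  commutativeMonoid = record { isCommutativeMonoid = isCommutativeMonoid }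

module CyclicGroups {T : TGrp} (L : Laws T) where
  open TGrp T
  open Laws L
  open CommutativeMonoid commutativeMonoid
    using (sym; trans; identityʳ; ∙-congˡ; setoid)
  open Orders commutativeMonoid
  open import Algebra.Properties.CommutativeMonoid.Mult commutativeMonoid
    using () renaming (×-congˡ to ^-≡; ×-homo-+ to ^-+)
  open import Relation.Binary.Reasoning.Setoid setoid

  Generator : Car → Set
  Generator γ = Valid γ × (∀ t → Valid t → ∃[ i ] (γ ^ i) ≈ t)

  ^-valid : ∀ {x} → Valid x → ∀ k → Valid (x ^ k)
  ^-valid v zero    = e-valid
  ^-valid v (suc k) = ·-valid v (^-valid v k)

  ^-≋ : ∀ {x n} → HasOrder x n → ∀ a b → Modulo._≋_ n (+ a) (+ b) → (x ^ a) ≈ (x ^ b)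
  ^-≋ {x} {n} o = Modulo.+≋+⇒ n sym λ a c n∣c → begin
    x ^ (a ℕ.+ c)      ≈⟨ ^-+ x a c ⟩
    (x ^ a) · (x ^ c)  ≈⟨ ∙-congˡ (from (o c) n∣c) ⟩
    (x ^ a) · e        ≈⟨ identityʳ _ ⟩
    x ^ a              ∎

  generator⇒CyclicOfOrder : ∀ {γ n} → Generator γ → 0 < n → HasOrder γ n → CyclicOfOrder T n
  generator⇒CyclicOfOrder {γ} {n} (γ-valid , γ-gen) 0<n o =
    ψ , (λ m → ^-valid γ-valid (m %ℕ n)) , homo , (λ m k → mk⇔ (inj m k) (λ d → ψ-cong (mk {m} {k} d))) , surj
    where
    instance _ = >-nonZero 0<n
    open Modulo n
    -- Reduction modulo n makes every integer exponent, negative ones included, a natural one.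
    ψ : ℤ → Car
    ψ m = γ ^ (m %ℕ n)
    ψ-cong : ∀ {m k} → m ≋ k → ψ m ≈ ψ k
    ψ-cong {m} {k} e = ^-≋ o _ _ (≋-trans (≋-sym (%≋ m)) (≋-trans e (%≋ k)))
    inj : ∀ m k → ψ m ≈ ψ k → + n ∣ (m - k)
    inj m k e = un (≋-trans (%≋ m) (≋-trans
      (≡⇒≋ (cong +_ (^-injective 0<n o (n%ℕd<d m n) (n%ℕd<d k n) e))) (≋-sym (%≋ k))))
    homo : ∀ m k → ψ (m + k) ≈ (ψ m · ψ k)
    homo m k = trans (^-≋ o _ _ (≋-trans (≋-sym (%≋ (m + k))) (+-cong (%≋ m) (%≋ k)))) (^-+ γ (m %ℕ n) _)
    surj : ∀ t → Valid t → ∃[ m ] ψ m ≈ t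
    surj t v with γ-gen t v
    ... | i , e = + i , trans (^-≋ o _ _ (≋-sym (%≋ (+ i)))) e

  -- Two injections give the equality: powers of γ with exponent below n into the list `rep`, and
  -- discrete logarithms of the listed elements, reduced modulo n, in the other direction.
  order-of-generator : ∀ {γ n N} → Generator γ → 0 < n → HasOrder γ n →
    (rep : Fin N → Car) → (∀ i → Valid (rep i)) → (∀ i j → rep i ≈ rep j → i ≡ j) →
    (∀ t → Valid t → ∃[ i ] rep i ≈ t) → n ≡ N
  order-of-generator {γ} {n} {N} (γ-valid , γ-gen) 0<n o rep rep-valid rep-inj rep-surj = ℕ.≤-antisym
    (Fin.injective⇒≤ {f = index} λ {i} {j} e → Fin.toℕ-injective (^-injective 0<n o (Fin.toℕ<n i) (Fin.toℕ<n j) (begin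
      γ ^ toℕ i      ≈⟨ proj₂ (rep-surj _ _) ⟨
      rep (index i)  ≡⟨ cong rep e ⟩
      rep (index j)  ≈⟨ proj₂ (rep-surj _ _) ⟩
      γ ^ toℕ j      ∎)))
    (Fin.injective⇒≤ {f = log} λ {i} {j} e → rep-inj i j (begin
      rep i             ≈⟨ proj₂ (log′ i) ⟨
      γ ^ toℕ (log i)   ≡⟨ cong (λ k → γ ^ toℕ k) e ⟩
      γ ^ toℕ (log j)   ≈⟨ proj₂ (log′ j) ⟩
      rep j             ∎))
    where
    instance _ = >-nonZero 0<n
    open Modulo n
    index : Fin n → Fin N
    index i = proj₁ (rep-surj (γ ^ toℕ i) (^-valid γ-valid (toℕ i)))
    log′ : ∀ i → ∃[ k ] (γ ^ toℕ k) ≈ rep i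
    log′ i with γ-gen (rep i) (rep-valid i)
    ... | k , e = Fin.fromℕ< (n%ℕd<d (+ k) n) , 
          trans (trans (^-≡ {γ} {y = (+ k) %ℕ n} (Fin.toℕ-fromℕ< _)) (^-≋ o _ _ (≋-sym (%≋ (+ k))))) e
    log : Fin N → Fin n
    log i = proj₁ (log′ i)

-- The relation _≈*_ of the quotient of T by ⟨h⟩ is a field because the quotients T1* and T2*
-- come with their own formulations of it.
record CyclicQuotient {T : TGrp} (L : Laws T) : Set₁ where
  open TGrp T
  open Orders (Laws.commutativeMonoid L)
  field
    h       : Car
    h-valid : Valid h
    r       : ℕ
    0<r     : 0 < r
    h-order : HasOrder h r
    _≈*_    : Car → Car → Set
    ≈*⇔     : ∀ s t → (s ≈* t) ⇔ (∃[ k ] s ≈ ((h ^ k) · t))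

module Quotient {T : TGrp} {L : Laws T} (C : CyclicQuotient L) where
  open TGrp T
  open Laws L
  open CyclicQuotient C
  open CommutativeMonoid commutativeMonoid
    using (refl; sym; trans; assoc; comm; identityˡ; identityʳ; ∙-cong; ∙-congˡ; ∙-congʳ; setoid)
  open Orders commutativeMonoid
  open import Algebra.Properties.CommutativeMonoid.Mult commutativeMonoid
    using () renaming (×-congʳ to ^-cong; ×-congˡ to ^-≡; ×-homo-+ to ^-+)
  open import Relation.Binary.Reasoning.Setoid setoid
  open CyclicGroups L using (Generator)

  T* : TGrp
  T* = record T { _≈_ = _≈*_ }

  ≈⇒≈* : ∀ {s t} → s ≈ t → s ≈* t
  ≈⇒≈* e′ = from (≈*⇔ _ _) (0 , trans e′ (sym (identityˡ _)))

  ≈*-sym : ∀ {s t} → s ≈* t → t ≈* s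
  ≈*-sym {s} {t} e′ with to (≈*⇔ s t) e′
  ... | k , e₁ = from (≈*⇔ t s) (k ℕ.* r ∸ k , (begin
    t                                        ≈⟨ identityˡ t ⟨
    e · t                                    ≈⟨ ∙-congʳ (from (h-order _) (ℕ.n∣m*n k)) ⟨
    (h ^ (k ℕ.* r)) · t                      ≈⟨ ∙-congʳ (^-≡ (ℕ.m∸n+n≡m (ℕ.m≤m*n k r {{>-nonZero 0<r}}))) ⟨
    (h ^ (k ℕ.* r ∸ k ℕ.+ k)) · t            ≈⟨ ∙-congʳ (^-+ h (k ℕ.* r ∸ k) k) ⟩
    ((h ^ (k ℕ.* r ∸ k)) · (h ^ k)) · t      ≈⟨ assoc _ _ _ ⟩
    (h ^ (k ℕ.* r ∸ k)) · ((h ^ k) · t)      ≈⟨ ∙-congˡ e₁ ⟨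
    (h ^ (k ℕ.* r ∸ k)) · s                  ∎))

  ≈*-trans : ∀ {s t u} → s ≈* t → t ≈* u → s ≈* u
  ≈*-trans {s} {t} {u} e′ e″ with to (≈*⇔ s t) e′ | to (≈*⇔ t u) e″
  ... | k , e₁ | j , e₂ = from (≈*⇔ s u) (k ℕ.+ j , (begin
    s                            ≈⟨ e₁ ⟩
    (h ^ k) · t                  ≈⟨ ∙-congˡ e₂ ⟩
    (h ^ k) · ((h ^ j) · u)      ≈⟨ assoc _ _ _ ⟨
    ((h ^ k) · (h ^ j)) · u      ≈⟨ ∙-congʳ (^-+ h k j) ⟨
    (h ^ (k ℕ.+ j)) · u          ∎))

  ·-cong* : ∀ {s s′ t t′} → s ≈* s′ → t ≈* t′ → (s · t) ≈* (s′ · t′)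
  ·-cong* {s} {s′} {t} {t′} e′ e″ with to (≈*⇔ s s′) e′ | to (≈*⇔ t t′) e″
  ... | k , e₁ | j , e₂ = from (≈*⇔ _ _) (k ℕ.+ j , (begin
    s · t                                    ≈⟨ ∙-cong e₁ e₂ ⟩
    ((h ^ k) · s′) · ((h ^ j) · t′)          ≈⟨ assoc _ _ _ ⟩
    (h ^ k) · (s′ · ((h ^ j) · t′))          ≈⟨ ∙-congˡ (assoc _ _ _) ⟨
    (h ^ k) · ((s′ · (h ^ j)) · t′)          ≈⟨ ∙-congˡ (∙-congʳ (comm _ _)) ⟩
    (h ^ k) · (((h ^ j) · s′) · t′)          ≈⟨ ∙-congˡ (assoc _ _ _) ⟩
    (h ^ k) · ((h ^ j) · (s′ · t′))          ≈⟨ assoc _ _ _ ⟨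
    ((h ^ k) · (h ^ j)) · (s′ · t′)          ≈⟨ ∙-congʳ (^-+ h k j) ⟨
    (h ^ (k ℕ.+ j)) · (s′ · t′)              ∎))

  laws* : Laws T*
  laws* = record
    { isCommutativeMonoid = record
      { isMonoid = record
        { isSemigroup = record
          { isMagma = record
            { isEquivalence = record { refl = ≈⇒≈* refl ; sym = ≈*-sym ; trans = ≈*-trans }
            ; ∙-cong = ·-cong* }
          ; assoc = λ x y z → ≈⇒≈* (assoc x y z) }
        ; identity = (λ x → ≈⇒≈* (identityˡ x)) , (λ x → ≈⇒≈* (identityʳ x)) }
      ; comm = λ x y → ≈⇒≈* (comm x y) }
    ; e-valid = e-valid
    ; ·-valid = ·-valid }

  open Orders (Laws.commutativeMonoid laws*) using () renaming (_^_ to _^*_; HasOrder to HasOrder*)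

  ^*≡^ : ∀ x k → x ^* k ≡ x ^ k
  ^*≡^ x zero    = ≡.refl
  ^*≡^ x (suc k) = cong (x ·_) (^*≡^ x k)

  -- The image of γ still generates. With h = γ ^ s and N = d r, a power γ ^ k becomes trivial
  -- exactly when it lies in ⟨h⟩, which `^∈⟨^⟩⇔` turns into d ∣ k.
  CyclicOfOrder-quotient : ∀ {γ N} .{{_ : NonZero r}} → Generator γ → 0 < N → HasOrder γ N →
                           CyclicOfOrder T* (N / r)
  CyclicOfOrder-quotient {γ} (γ-valid , γ-gen) 0<N o with γ-gen h h-valid
  ... | s , γˢ≈h with HasOrder-^⇒∣ s o (HasOrder-resp (sym γˢ≈h) h-order)
  ...   | ℕ.divides d ≡.refl = subst (CyclicOfOrder T*) (≡.sym (m*n/n≡m d r))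
    (CyclicGroups.generator⇒CyclicOfOrder laws* {γ}
      (γ-valid , λ t v → let i , e′ = γ-gen t v in i , subst (_≈* t) (≡.sym (^*≡^ γ i)) (≈⇒≈* e′))
      (>-nonZero⁻¹ d {{ℕ.m*n≢0⇒m≢0 d {{>-nonZero 0<N}}}}) order*)
    where
    γᵏ∈⟨h⟩ : ∀ k → (∃[ j ] (γ ^ k) ≈ ((γ ^ s) ^ j)) ⇔ (d ℕ.∣ k)
    γᵏ∈⟨h⟩ = ^∈⟨^⟩⇔ d r s o (HasOrder-resp (sym γˢ≈h) h-order)
    order* : HasOrder* γ d
    order* k rewrite ^*≡^ γ k = mk⇔
      (λ z → to (γᵏ∈⟨h⟩ k)
        (let j , e′ = to (≈*⇔ _ _) z in j , trans e′ (trans (identityʳ _) (sym (^-cong j γˢ≈h)))))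
      (λ d∣k → let j , e′ = from (γᵏ∈⟨h⟩ k) d∣k in
        from (≈*⇔ _ _) (j , trans e′ (trans (^-cong j γˢ≈h) (sym (identityʳ _)))))

-- The prime field.

module PrimeModulus {p : ℕ} (p-prime : Prime p) where
  open Modulo p public

  instance
    p≢0 : NonZero p
    p≢0 = prime⇒nonZero p-prime

  1<p : 1 < p
  1<p = nonTrivial⇒n>1 p {{prime⇒nonTrivial p-prime}}

  noZeroDivisors : ∀ a b → a * b ≋ 0ℤ → a ≋ 0ℤ ⊎ b ≋ 0ℤ
  noZeroDivisors a b e with euclidsLemma ∣ a ∣ ∣ b ∣ p-prime (subst (p ℕ.∣_) (ℤ.abs-* a b) (≋0⇒∣ e))
  ... | inj₁ d = inj₁ (∣⇒≋0 {a} d)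
  ... | inj₂ d = inj₂ (∣⇒≋0 {b} d)

  1≋̸0 : ¬ 1ℤ ≋ 0ℤ
  1≋̸0 e = ℕ.<-irrefl (≡.sym (ℕ.∣1⇒≡1 (≋0⇒∣ e))) 1<p

  ∤-* : ∀ a b → ¬ (+ p) ∣ a → ¬ (+ p) ∣ b → ¬ (+ p) ∣ (a * b)
  ∤-* a b p∤a p∤b p∣ab =
    [ (λ e → p∤a (≋0⇒∣ e)) , (λ e → p∤b (≋0⇒∣ e)) ]′ (noZeroDivisors a b (∣⇒≋0 {a * b} p∣ab))

  ∣-*ˡ : ∀ a b → (+ p) ∣ a → (+ p) ∣ (a * b)
  ∣-*ˡ a b p∣a = Signed.∣⇒∣ᵤ (Signed.∣m⇒∣m*n b (Signed.∣ᵤ⇒∣ {+ p} {a} p∣a))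

  residue : Fin p → ℤ
  residue i = + toℕ i

  residue-surjective : ∀ a → ∃[ i ] residue i ≋ a
  residue-surjective a = Fin.fromℕ< (n%ℕd<d a p) ,
    ≋-trans (≡⇒≋ (cong +_ (Fin.toℕ-fromℕ< _))) (≋-sym (%≋ a))

  residue-injective : ∀ i j → residue i ≋ residue j → i ≡ j
  residue-injective i j e = Fin.toℕ-injective (residue-unique (Fin.toℕ<n i) (Fin.toℕ<n j) e)

  ℤ/p-finiteDomain : FiniteDomain ℤ/n
  ℤ/p-finiteDomain = record
    { _≟_ = _≋?_ ; noZeroDivisors = noZeroDivisors ; 1≉0 = 1≋̸0
    ; rep = residue ; rep-surjective = residue-surjective }

  module 𝔽 = UnitsOfFiniteDomain ℤ/p-finiteDomain

-- The form Λ and primitive pairs.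

Λ-mulQ : ∀ P Q x y → Λ P Q (mulQ P Q x y) ≡ Λ P Q x * Λ P Q y
Λ-mulQ P Q (a , b) (c , d) = lemma P Q a b c d
  where
  lemma : ∀ P Q a b c d →
    (a * c - Q * b * d) * (a * c - Q * b * d)
    - P * (b * c + a * d - P * b * d) * (a * c - Q * b * d)
    + Q * (b * c + a * d - P * b * d) * (b * c + a * d - P * b * d)
    ≡ (a * a - P * b * a + Q * b * b) * (c * c - P * d * c + Q * d * d)
  lemma = solve-∀

Λ-scale : ∀ P Q a b g → Λ P Q (a * g , b * g) ≡ Λ P Q (a , b) * (g * g)
Λ-scale P Q a b g = lemma P Q a b g
  where
  lemma : ∀ P Q a b g → (a * g) * (a * g) - P * (b * g) * (a * g) + Q * (b * g) * (b * g)
    ≡ (a * a - P * b * a + Q * b * b) * (g * g)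
  lemma = solve-∀

mulQ-identityʳ : ∀ P Q x → mulQ P Q x (1ℤ , 0ℤ) ≡ x
mulQ-identityʳ P Q (a , b) = cong₂ _,_ (lemma₁ Q a b) (lemma₂ P a b)
  where
  lemma₁ : ∀ Q a b → a * 1ℤ - Q * b * 0ℤ ≡ a
  lemma₁ = solve-∀
  lemma₂ : ∀ P a b → b * 1ℤ + a * 0ℤ - P * b * 0ℤ ≡ b
  lemma₂ = solve-∀

primitive-part : ∀ a b → ¬ (a ≡ 0ℤ × b ≡ 0ℤ) →
  ∃[ a′ ] ∃[ b′ ] ∃[ g ] (Prim (a′ , b′) × a ≡ a′ * g × b ≡ b′ * g)
primitive-part a b ≢0 with Signed.∣ᵤ⇒∣ {+ g} {a} (gcd[m,n]∣m ∣ a ∣ ∣ b ∣) | Signed.∣ᵤ⇒∣ {+ g} {b} (gcd[m,n]∣n ∣ a ∣ ∣ b ∣)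
  where
  g : ℕ
  g = gcd ∣ a ∣ ∣ b ∣
... | Signed.divides a′ a≡ | Signed.divides b′ b≡ = a′ , b′ , + g , cong +_ c≡1 , a≡ , b≡
  where
  g c : ℕ
  g = gcd ∣ a ∣ ∣ b ∣
  c = gcd ∣ a′ ∣ ∣ b′ ∣
  g≢0 : NonZero g
  g≢0 = ℕ.≢-nonZero λ g≡0 → ≢0
    ( ℤ.∣i∣≡0⇒i≡0 (gcd[m,n]≡0⇒m≡0 {∣ a ∣} {∣ b ∣} g≡0)
    , ℤ.∣i∣≡0⇒i≡0 (gcd[m,n]≡0⇒n≡0 ∣ a ∣ {∣ b ∣} g≡0))
  cg∣ : ∀ z′ {z} → z ≡ z′ * + g → c ℕ.∣ ∣ z′ ∣ → c ℕ.* g ℕ.∣ ∣ z ∣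
  cg∣ z′ ≡.refl d = subst (c ℕ.* g ℕ.∣_) (≡.sym (ℤ.abs-* z′ (+ g))) (ℕ.*-monoˡ-∣ g d)
  -- The product c g divides both a and b, hence their gcd g.
  c≡1 : c ≡ 1
  c≡1 = ℕ.∣1⇒≡1 (ℕ.*-cancelʳ-∣ g {{g≢0}} (subst (c ℕ.* g ℕ.∣_) (≡.sym (ℕ.*-identityˡ g))
    (gcd-greatest (cg∣ a′ a≡ (gcd[m,n]∣m ∣ a′ ∣ ∣ b′ ∣)) (cg∣ b′ b≡ (gcd[m,n]∣n ∣ a′ ∣ ∣ b′ ∣)))))

-- Passing between integer pairs and the classes in K and G.

module Classes (P Q : ℤ) {p : ℕ} (p-prime : Prime p) (p∤Q : ¬ (+ p) ∣ Q) where
  open PrimeModulus p-prime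

  Unit : Pair → Set
  Unit x = ¬ (+ p) ∣ Λ P Q x

  σ : Pair
  σ = (P , 1ℤ)

  prim⇒∤ : ∀ {a b} → Prim (a , b) → (+ p) ∣ a → (+ p) ∣ b → ⊥
  prim⇒∤ {a} {b} prim p∣a p∣b = ℕ.<-irrefl (≡.sym p≡1) 1<p
    where
    p≡1 : p ≡ 1
    p≡1 = ℕ.∣1⇒≡1 (subst (p ℕ.∣_) (ℤ.+-injective prim) (gcd-greatest {∣ a ∣} {∣ b ∣} p∣a p∣b))

  unit⇒Λ≢0 : ∀ {x} → Unit x → ¬ Λ P Q x ≡ 0ℤ
  unit⇒Λ≢0 ux e = ux (subst ((+ p) ∣_) (≡.sym e) (p ℕ.∣0))

  unit-1 : Unit (1ℤ , 0ℤ)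
  unit-1 d = 1≋̸0 (∣⇒≋0 (subst ((+ p) ∣_) (lemma P Q) d))
    where
    lemma : ∀ P Q → 1ℤ * 1ℤ - P * 0ℤ * 1ℤ + Q * 0ℤ * 0ℤ ≡ 1ℤ
    lemma = solve-∀

  unit-σ : Unit σ
  unit-σ d = p∤Q (subst ((+ p) ∣_) (lemma P Q) d)
    where
    lemma : ∀ P Q → P * P - P * 1ℤ * P + Q * 1ℤ * 1ℤ ≡ Q
    lemma = solve-∀

  unit-mulQ : ∀ {x y} → Unit x → Unit y → Unit (mulQ P Q x y)
  unit-mulQ {x} {y} ux uy d = ∤-* (Λ P Q x) (Λ P Q y) ux uy (subst ((+ p) ∣_) (Λ-mulQ P Q x y) d)

  unit-shiftPow : ∀ n → Unit (shiftPow P Q n)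
  unit-shiftPow zero    = unit-1
  unit-shiftPow (suc n) = unit-mulQ {σ} {shiftPow P Q n} unit-σ (unit-shiftPow n)

  -- Dividing by the gcd g removes the factor g² from Λ, so a value prime to p stays prime to p.
  primitive-representative : ∀ x → Unit x → ∃[ z ] (inK P Q p z × z ∼ x)
  primitive-representative (a , b) ux
    with primitive-part a b (λ { (≡.refl , ≡.refl) → unit⇒Λ≢0 {0ℤ , 0ℤ} ux (lemma P Q) })
    where
    lemma : ∀ P Q → 0ℤ * 0ℤ - P * 0ℤ * 0ℤ + Q * 0ℤ * 0ℤ ≡ 0ℤ
    lemma = solve-∀
  ... | a′ , b′ , g , prim , ≡.refl , ≡.refl =
    (a′ , b′) , ((prim , unit⇒Λ≢0 {a′ , b′} uz) , uz) , lemma a′ b′ g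
    where
    uz : Unit (a′ , b′)
    uz d = ux (subst ((+ p) ∣_) (≡.sym (Λ-scale P Q a′ b′ g)) (∣-*ˡ (Λ P Q (a′ , b′)) (g * g) d))
    lemma : ∀ a b g → a * (b * g) ≡ b * (a * g)
    lemma = solve-∀

  -- Proportionality gives Λ(z) d² = Λ(w) b² and Λ(z) c² = Λ(w) a². If p divided Λ(z), it would
  -- divide both a and b, against primitivity.
  prim∼unit⇒unit : ∀ {z w} → Prim z → Unit w → z ∼ w → Unit z
  prim∼unit⇒unit {a , b} {c , d} prim uw ad≡bc uz = prim⇒∤ {a} {b} prim (div-square a eq-a) (div-square b eq-b)
    where
    W : ℤ
    W = Λ P Q (c , d)
    div-square : ∀ s {t} → Λ P Q (a , b) * t ≡ W * (s * s) → (+ p) ∣ s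
    div-square s {t} eq with p ℕ.∣? ∣ s ∣
    ... | yes p∣s = p∣s
    ... | no p∤s = ⊥-elim (∤-* W (s * s) uw (∤-* s s p∤s p∤s)
                     (subst ((+ p) ∣_) eq (∣-*ˡ (Λ P Q (a , b)) t uz)))
    lemma-b : ∀ P Q a b d → (a * a - P * b * a + Q * b * b) * (d * d)
      ≡ (a * d) * (a * d) - P * (b * d) * (a * d) + Q * (b * d) * (b * d)
    lemma-b = solve-∀
    lemma-b′ : ∀ P Q b c d → (b * c) * (b * c) - P * (b * d) * (b * c) + Q * (b * d) * (b * d)
      ≡ (c * c - P * d * c + Q * d * d) * (b * b)
    lemma-b′ = solve-∀
    eq-b : Λ P Q (a , b) * (d * d) ≡ W * (b * b)
    eq-b = ≡.trans (lemma-b P Q a b d)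
      (≡.trans (cong (λ t → t * t - P * (b * d) * t + Q * (b * d) * (b * d)) ad≡bc) (lemma-b′ P Q b c d))
    lemma-a : ∀ P Q a b c → (a * a - P * b * a + Q * b * b) * (c * c)
      ≡ (a * c) * (a * c) - P * (b * c) * (a * c) + Q * (b * c) * (b * c)
    lemma-a = solve-∀
    lemma-a′ : ∀ P Q a c d → (a * c) * (a * c) - P * (a * d) * (a * c) + Q * (a * d) * (a * d)
      ≡ (c * c - P * d * c + Q * d * d) * (a * a)
    lemma-a′ = solve-∀
    eq-a : Λ P Q (a , b) * (c * c) ≡ W * (a * a)
    eq-a = ≡.trans (lemma-a P Q a b c)
      (≡.trans (cong (λ t → (a * c) * (a * c) - P * t * (a * c) + Q * t * t) (≡.sym ad≡bc)) (lemma-a′ P Q a c d))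

  b≋0⇒Λ≋a² : ∀ a b → b ≋ 0ℤ → Λ P Q (a , b) ≋ a * a
  b≋0⇒Λ≋a² a b b≋0 = ≋-trans
    (+-cong (sub-cong (≋-refl {a * a}) (*-cong (*-cong (≋-refl {P}) b≋0) (≋-refl {a})))
            (*-cong (*-cong (≋-refl {Q}) b≋0) b≋0))
    (≡⇒≋ (lemma P Q a))
    where
    lemma : ∀ P Q a → a * a - P * 0ℤ * a + Q * 0ℤ * 0ℤ ≡ a * a
    lemma = solve-∀

  ≋0⇒Λ≋0 : ∀ a b → a ≋ 0ℤ → b ≋ 0ℤ → Λ P Q (a , b) ≋ 0ℤ
  ≋0⇒Λ≋0 a b a≋0 b≋0 = ≋-trans (b≋0⇒Λ≋a² a b b≋0) (*-cong a≋0 a≋0)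

  -- Modulo p the form reduces to a² once p ∣ b, and primitivity keeps p from dividing a. So G lies
  -- inside K.
  inG⇒unit : ∀ {x} → inG P Q p x → Unit x
  inG⇒unit {a , b} ((prim , _) , p∣b) p∣Λ with p ℕ.∣? ∣ a ∣
  ... | yes p∣a = prim⇒∤ {a} {b} prim p∣a p∣b
  ... | no p∤a = ∤-* a a p∤a p∤a
    (≋0⇒∣ (≋-trans (≋-sym (b≋0⇒Λ≋a² a b (∣⇒≋0 {b} p∣b))) (∣⇒≋0 {Λ P Q (a , b)} p∣Λ)))

  -- Quantifying over all pairs of unit norm, rather than primitive ones, makes φ compatible with products.
  record UnitIso (T : TGrp) (φ : Pair → TGrp.Car T) : Set where
    open TGrp T
    field
      isEquivalence : IsEquivalence _≈_
      φ-valid : ∀ x → Unit x → Valid (φ x)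
      φ-cong  : ∀ x y → Unit x → Unit y → x ∼ y → φ x ≈ φ y
      φ-homo  : ∀ x y → Unit x → Unit y → φ (mulQ P Q x y) ≈ (φ x · φ y)
      φ-surj  : ∀ t → Valid t → ∃[ x ] (Unit x × φ x ≈ t)
      φ-ker   : ∀ x → Unit x → (φ x ≈ e) ⇔ (+ p) ∣ proj₂ x

    open IsEquivalence isEquivalence public

    isoVia : IsoVia P Q (inK P Q p) _∼_ (inG P Q p) T φ
    isoVia = (λ x (_ , ux) → φ-valid x ux)
      , (λ x y (_ , ux) (_ , uy) → φ-cong x y ux uy)
      , (λ x y z (_ , ux) (_ , uy) (prim , _) z∼xy →
          let uxy = unit-mulQ {x} {y} ux uy in
          trans (φ-cong z (mulQ P Q x y) (prim∼unit⇒unit {z} {mulQ P Q x y} prim uxy z∼xy) uxy z∼xy) (φ-homo x y ux uy))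
      , (λ t v → let x , ux , φx≈t = φ-surj t v
                     z , kz , z∼x  = primitive-representative x ux
                 in z , kz , trans (φ-cong z x (proj₂ kz) ux z∼x) φx≈t)
      , (λ x (gx , ux) → mk⇔ (λ e → gx , to (φ-ker x ux) e) (λ (_ , d) → from (φ-ker x ux) d))

    φ-1 : φ (1ℤ , 0ℤ) ≈ e
    φ-1 = from (φ-ker _ unit-1) (p ℕ.∣0)

  -- Turns kernel information into membership in G*: the primitive representative of the shifted
  -- pair is the required element of G, matched with x by n shifts on one side and none on the
  -- other.
  shift-into-G : ∀ {T φ} → UnitIso T φ → ∀ x n → Unit x →
    TGrp._≈_ T (φ (mulQ P Q x (shiftPow P Q n))) (TGrp.e T) → inGstar P Q p x
  shift-into-G {φ = φ} U x n ux φ≈e =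
    let xσⁿ = mulQ P Q x (shiftPow P Q n)
        uxσⁿ = unit-mulQ {x} {shiftPow P Q n} ux (unit-shiftPow n)
        z , (gz , uz) , z∼xσⁿ = primitive-representative xσⁿ uxσⁿ
    in z , (gz , to (φ-ker z uz) (trans (φ-cong z xσⁿ uz uxσⁿ z∼xσⁿ) φ≈e)) ,
       n , 0 , subst (xσⁿ ∼_) (≡.sym (mulQ-identityʳ P Q z)) (∼-sym z xσⁿ z∼xσⁿ)
    where
    open UnitIso U
    ∼-sym : ∀ x y → x ∼ y → y ∼ x
    ∼-sym (a , b) (c , d) e = ≡.trans (ℤ.*-comm c b) (≡.trans (≡.sym e) (ℤ.*-comm a d))

  -- A shift multiplies the value of `φ` by `φ σ`. The hypothesis makes this the inverse of `h`, so
  -- shifts generate ⟨h⟩ and agreement up to shift becomes equality modulo ⟨h⟩.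
  module Star {T : TGrp} {φ : Pair → TGrp.Car T} (U : UnitIso T φ) {L : Laws T} (C : CyclicQuotient L)
    (σh≈e : TGrp._≈_ T (TGrp._·_ T (φ σ) (CyclicQuotient.h C)) (TGrp.e T)) where

    open TGrp T
    open CyclicQuotient C
    open UnitIso U using (φ-valid; φ-cong; φ-homo; φ-ker; φ-1; isoVia)
    open Laws L
    open Orders commutativeMonoid
    open CommutativeMonoid commutativeMonoid
      using (sym; trans; assoc; comm; identityˡ; identityʳ; ∙-congˡ; ∙-congʳ; setoid)
    open import Algebra.Properties.CommutativeMonoid.Mult commutativeMonoid
      using (×-distrib-+) renaming (×-congʳ to ^-cong; ×-congˡ to ^-≡; ×-homo-+ to ^-+)
    open import Relation.Binary.Reasoning.Setoid setoid
    open Quotient C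

    -- `φ σ` is h⁻¹, and r - 1 is the natural exponent that stands for -1.
    q : ℕ
    q = r ∸ 1

    φσ≈ : φ σ ≈ (h ^ q)
    φσ≈ = begin
      φ σ                    ≈⟨ identityʳ _ ⟨
      φ σ · e                ≈⟨ ∙-congˡ (^order h-order) ⟨
      φ σ · (h ^ r)          ≈⟨ ∙-congˡ (^-≡ (ℕ.m+[n∸m]≡n 0<r)) ⟨
      φ σ · (h · (h ^ q))    ≈⟨ assoc _ _ _ ⟨
      (φ σ · h) · (h ^ q)    ≈⟨ ∙-congʳ σh≈e ⟩
      e · (h ^ q)            ≈⟨ identityˡ _ ⟩
      h ^ q                  ∎

    φ-shiftPow : ∀ n → φ (shiftPow P Q n) ≈ (φ σ ^ n)
    φ-shiftPow zero    = φ-1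
    φ-shiftPow (suc n) = trans (φ-homo σ (shiftPow P Q n) unit-σ (unit-shiftPow n)) (∙-congˡ (φ-shiftPow n))

    φ-shift : ∀ x n → Unit x → φ (mulQ P Q x (shiftPow P Q n)) ≈ (φ x · (φ σ ^ n))
    φ-shift x n ux = trans (φ-homo x (shiftPow P Q n) ux (unit-shiftPow n)) (∙-congˡ (φ-shiftPow n))

    σh^ : ∀ n → ((φ σ ^ n) · (h ^ n)) ≈ e
    σh^ n = trans (sym (×-distrib-+ (φ σ) h n)) (trans (^-cong n σh≈e) (ε^ n))

    φ-cong* : ∀ x y → Unit x → Unit y → x ≈π[ P , Q ] y → φ x ≈* φ y
    -- Solving φ(x) h⁻ᵐ = φ(y) h⁻ⁿ gives the factor hᵐ⁻ⁿ; the natural exponent q n stands for -n.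
    φ-cong* x y ux uy (m , n , e′) = from (≈*⇔ _ _) (q ℕ.* n ℕ.+ m , (begin
      φ x                                    ≈⟨ identityʳ _ ⟨
      φ x · e                                ≈⟨ ∙-congˡ (σh^ m) ⟨
      φ x · ((φ σ ^ m) · (h ^ m))            ≈⟨ assoc _ _ _ ⟨
      (φ x · (φ σ ^ m)) · (h ^ m)            ≈⟨ ∙-congʳ (φ-shift x m ux) ⟨
      φ (mulQ P Q x (shiftPow P Q m)) · (h ^ m)
        ≈⟨ ∙-congʳ (φ-cong (mulQ P Q x (shiftPow P Q m)) (mulQ P Q y (shiftPow P Q n))
             (unit-mulQ {x} {shiftPow P Q m} ux (unit-shiftPow m))
             (unit-mulQ {y} {shiftPow P Q n} uy (unit-shiftPow n)) e′) ⟩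
      φ (mulQ P Q y (shiftPow P Q n)) · (h ^ m)
                                             ≈⟨ ∙-congʳ (φ-shift y n uy) ⟩
      (φ y · (φ σ ^ n)) · (h ^ m)            ≈⟨ assoc _ _ _ ⟩
      φ y · ((φ σ ^ n) · (h ^ m))            ≈⟨ ∙-congˡ (∙-congʳ (trans (^-cong n φσ≈) (^-* h q n))) ⟩
      φ y · ((h ^ (q ℕ.* n)) · (h ^ m))      ≈⟨ ∙-congˡ (^-+ h (q ℕ.* n) m) ⟨
      φ y · (h ^ (q ℕ.* n ℕ.+ m))            ≈⟨ comm _ _ ⟩
      (h ^ (q ℕ.* n ℕ.+ m)) · φ y            ∎))

    φ-ker*⇒ : ∀ x → Unit x → φ x ≈* e → inGstar P Q p x
    φ-ker*⇒ x ux e* with to (≈*⇔ (φ x) e) e*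
    -- Since φ(x) is h ^ k, exactly k shifts carry x into the kernel.
    ... | k , e′ = shift-into-G U x k ux (begin
      φ (mulQ P Q x (shiftPow P Q k))      ≈⟨ φ-shift x k ux ⟩
      φ x · (φ σ ^ k)                      ≈⟨ ∙-congʳ (trans e′ (identityʳ _)) ⟩
      (h ^ k) · (φ σ ^ k)                  ≈⟨ comm _ _ ⟩
      (φ σ ^ k) · (h ^ k)                  ≈⟨ σh^ k ⟩
      e                                    ∎)

    φ-ker*⇐ : ∀ x → Unit x → inGstar P Q p x → φ x ≈* e
    φ-ker*⇐ x ux (g , g∈G , x≈g) =
      ≈*-trans (φ-cong* x g ux ug x≈g) (≈⇒≈* (from (φ-ker g ug) (proj₂ g∈G)))
      where
      ug : Unit g
      ug = inG⇒unit {g} g∈G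

    isoVia* : IsoVia P Q (inK P Q p) (λ x y → x ≈π[ P , Q ] y) (inGstar P Q p) T* φ
    isoVia* = (λ x (_ , ux) → φ-valid x ux)
      , (λ x y (_ , ux) (_ , uy) → φ-cong* x y ux uy)
      , (λ x y z kx ky gz z∼xy → ≈⇒≈* (proj₁ (proj₂ (proj₂ isoVia)) x y z kx ky gz z∼xy))
      , (λ t v → let x , kx , φx≈t = proj₁ (proj₂ (proj₂ (proj₂ isoVia))) t v in x , kx , ≈⇒≈* φx≈t)
      , (λ x (_ , ux) → mk⇔ (φ-ker*⇒ x ux) (φ-ker*⇐ x ux))

-- Replacing the equality of a target group by an equivalent one.

module _ {T : TGrp} (_≈′_ : TGrp.Car T → TGrp.Car T → Set)
  (⇒′ : ∀ s t → TGrp._≈_ T s t → s ≈′ t) (⇐′ : ∀ s t → s ≈′ t → TGrp._≈_ T s t) where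

  IsoVia-≈ : ∀ P Q {K _≈S_ Ker φ} → IsoVia P Q K _≈S_ Ker T φ → IsoVia P Q K _≈S_ Ker (record T { _≈_ = _≈′_ }) φ
  IsoVia-≈ P Q (valid , cong′ , homo , surj , ker) = valid
    , (λ x y kx ky x≈y → ⇒′ _ _ (cong′ x y kx ky x≈y))
    , (λ x y z kx ky gz z∼xy → ⇒′ _ _ (homo x y z kx ky gz z∼xy))
    , (λ t v → let x , kx , e′ = surj t v in x , kx , ⇒′ _ _ e′)
    , (λ x kx → mk⇔ (λ e′ → to (ker x kx) (⇐′ _ _ e′)) (λ k → ⇒′ _ _ (from (ker x kx) k)))

  CyclicOfOrder-≈ : ∀ {n} → CyclicOfOrder T n → CyclicOfOrder (record T { _≈_ = _≈′_ }) n
  CyclicOfOrder-≈ (ψ , valid , homo , inj , surj) = ψ , valid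
    , (λ m k → ⇒′ _ _ (homo m k))
    , (λ m k → mk⇔ (λ e′ → to (inj m k) (⇐′ _ _ e′)) (λ d → ⇒′ _ _ (from (inj m k) d)))
    , (λ t v → let m , e′ = surj t v in m , ⇒′ _ _ e′)

-- The group 𝔽ₚ^× and Fermat inverses.

module PrimeField {p : ℕ} (p-prime : Prime p) where
  open PrimeModulus p-prime
  open CommutativeRing ℤ/n using (*-commutativeMonoid; *-isCommutativeMonoid)
  open import Algebra.Properties.CommutativeMonoid.Mult *-commutativeMonoid using () renaming (×-congʳ to ^-cong)

  𝔽ₚ× : TGrp
  𝔽ₚ× = record (T2 p) { _≈_ = _≋_ }

  𝔽ₚ×-laws : Laws 𝔽ₚ×
  𝔽ₚ×-laws = record
    { isCommutativeMonoid = *-isCommutativeMonoid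
    ; e-valid = λ d → 1≋̸0 (∣⇒≋0 {1ℤ} d)
    ; ·-valid = λ {a} {b} → ∤-* a b }

  open Orders *-commutativeMonoid
  open CyclicGroups 𝔽ₚ×-laws

  ^≡ℤ^ : ∀ x k → x ^ k ≡ x ℤ.^ k
  ^≡ℤ^ x zero    = ≡.refl
  ^≡ℤ^ x (suc k) = cong (λ y → x * y) (^≡ℤ^ x k)

  unit-residue : Fin (p ∸ 1) → ℤ
  unit-residue i = + suc (toℕ i)

  suc-toℕ<p : ∀ (i : Fin (p ∸ 1)) → suc (toℕ i) < p
  suc-toℕ<p i = subst (suc (toℕ i) <_) (ℕ.m+[n∸m]≡n (ℕ.<⇒≤ 1<p)) (s<s (Fin.toℕ<n i))

  unit-residue-valid : ∀ i → ¬ (+ p) ∣ unit-residue i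
  unit-residue-valid i d with residue-unique (suc-toℕ<p i) (ℕ.<-trans z<s 1<p) (∣⇒≋0 {unit-residue i} d)
  ... | ()

  unit-residue-injective : ∀ i j → unit-residue i ≋ unit-residue j → i ≡ j
  unit-residue-injective i j e = Fin.toℕ-injective
    (ℕ.suc-injective (residue-unique (suc-toℕ<p i) (suc-toℕ<p j) e))

  unit-residue-surjective : ∀ t → ¬ (+ p) ∣ t → ∃[ i ] unit-residue i ≋ t
  unit-residue-surjective t p∤t with t %ℕ p | n%ℕd<d t p | %≋ t
  ... | zero  | _   | t≋ = ⊥-elim (p∤t (≋0⇒∣ t≋))
  ... | suc k | k<p | t≋ = Fin.fromℕ< k<p-1 ,
      ≋-trans (≡⇒≋ (cong (λ i → + suc i) (Fin.toℕ-fromℕ< k<p-1))) (≋-sym t≋)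
    where
    k<p-1 : k < p ∸ 1
    k<p-1 = ℕ.∸-monoˡ-< k<p (ℕ.s≤s ℕ.z≤n)

  𝔽ₚ×-generator : ∃[ γ ] (Generator γ × HasOrder γ (p ∸ 1))
  𝔽ₚ×-generator =
    let g , g≋̸0 , gen = 𝔽.cyclic
        n , 0<n , o = 𝔽.order g≋̸0
        generator = (λ d → g≋̸0 (∣⇒≋0 {g} d)) , (λ t p∤t → gen t (λ t≋0 → p∤t (≋0⇒∣ t≋0)))
    in g , generator , subst (HasOrder g) (order-of-generator generator 0<n o unit-residue unit-residue-valid
         unit-residue-injective unit-residue-surjective) o

  0<p-1 : 0 < p ∸ 1
  0<p-1 = ℕ.m<n⇒0<n∸m 1<p

  -- Read off from the generator: x is a power of γ, and γ ^ (p - 1) is 1.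
  fermat : ∀ x → ¬ (+ p) ∣ x → x ^ (p ∸ 1) ≋ 1ℤ
  fermat x p∤x = let γ , (_ , gen) , o = 𝔽ₚ×-generator
                     i , γⁱ≋x = gen x p∤x
    in ≋-trans (^-cong (p ∸ 1) (≋-sym γⁱ≋x)) (≋-trans (^-swap γ i (p ∸ 1)) (≋-trans (^-cong i (^order o)) (ε^ i)))

  -- One more factor x turns the exponent p - 2 into p - 1. The truncated subtraction is exact
  -- because p ≥ 2; for p = 2 the inverse is the empty power 1.
  inv-* : ∀ x → ¬ (+ p) ∣ x → x * inv p x ≋ 1ℤ
  inv-* x p∤x = ≋-trans (≡⇒≋ (≡.trans (cong (λ k → x ℤ.^ k) (≡.sym (ℕ.+-∸-assoc 1 {p} {2} 1<p)))
    (≡.sym (^≡ℤ^ x (p ∸ 1))))) (fermat x p∤x)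

-- Reducible f modulo p: roots and evaluation.

module Split (P Q : ℤ) {p : ℕ} (p-prime : Prime p) (p∤Q : ¬ (+ p) ∣ Q) where
  open PrimeModulus p-prime
  open PrimeField p-prime
  open Classes P Q p-prime p∤Q
  open CommutativeRing ℤ/n using (*-commutativeMonoid; setoid)
  open Orders *-commutativeMonoid
  open import Algebra.Properties.CommutativeMonoid.Mult *-commutativeMonoid
    using (×-distrib-+) renaming (×-congʳ to ^-cong)
  open import Relation.Binary.Reasoning.Setoid setoid

  -- Congruence by certificate: X - Y is an explicit combination of D and E, both zero modulo p.
  -- Typically D and E are P - (u + v) and Q - u v, and A and B are their cofactors.
  ≋-combination : ∀ {X} Y {D E} A B → D ≋ 0ℤ → E ≋ 0ℤ → X ≡ Y + (D * A + E * B) → X ≋ Y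
  ≋-combination Y {D} {E} A B D≋0 E≋0 ≡.refl = ≋-trans
    (+-cong (≋-refl {Y}) (+-cong (*-cong D≋0 (≋-refl {A})) (*-cong E≋0 (≋-refl {B}))))
    (≡⇒≋ (lemma Y A B))
    where
    lemma : ∀ Y A B → Y + (0ℤ * A + 0ℤ * B) ≡ Y
    lemma = solve-∀

  -≋0⇒≋ : ∀ {a b} → a - b ≋ 0ℤ → a ≋ b
  -≋0⇒≋ e = mk (≋0⇒∣ e)

  ≋⇒-≋0 : ∀ {a b} → a ≋ b → a - b ≋ 0ℤ
  ≋⇒-≋0 {a} {b} e = ∣⇒≋0 {a - b} (un e)

  ∤⇒≋̸0 : ∀ a → ¬ (+ p) ∣ a → ¬ a ≋ 0ℤ
  ∤⇒≋̸0 a p∤a e = p∤a (≋0⇒∣ e)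

  *-cancelʳ-≋ : ∀ {a b} c → ¬ (+ p) ∣ c → a * c ≋ b * c → a ≋ b
  *-cancelʳ-≋ {a} {b} c p∤c e = 𝔽.*-cancelˡ {c} {a} {b} (∤⇒≋̸0 c p∤c)
    (≋-trans (≡⇒≋ (ℤ.*-comm c a)) (≋-trans e (≡⇒≋ (ℤ.*-comm b c))))

  /-* : ∀ a b → ¬ (+ p) ∣ b → a * inv p b * b ≋ a
  /-* a b p∤b = begin
    a * inv p b * b    ≡⟨ lemma a (inv p b) b ⟩
    a * (b * inv p b)  ≈⟨ *-cong (≋-refl {a}) (inv-* b p∤b) ⟩
    a * 1ℤ             ≡⟨ ℤ.*-identityʳ a ⟩
    a                  ∎
    where
    lemma : ∀ a i b → a * i * b ≡ a * (b * i)
    lemma = solve-∀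

  infix 7 _at_
  -- For a root u of f this is evaluation 𝔽ₚ[t]/f → 𝔽ₚ at t = u, applied to w₁ - w₀t; hence its
  -- compatibility with `mulQ`.
  _at_ : Pair → ℤ → ℤ
  (a , b) at u = a - b * u

  module Roots (u v : ℤ) (factors : Factors P Q p u v) where

    P≋ : P - (u + v) ≋ 0ℤ
    P≋ = ≋⇒-≋0 (mk {P} {u + v} (proj₁ factors))

    Q≋ : Q - u * v ≋ 0ℤ
    Q≋ = ≋⇒-≋0 (mk {Q} {u * v} (proj₂ factors))

    Λ≋ : ∀ x → Λ P Q x ≋ (x at u) * (x at v)
    Λ≋ (a , b) = ≋-combination ((a - b * u) * (a - b * v)) (- (b * a)) (b * b) P≋ Q≋ (lemma P Q u v a b)
      where
      lemma : ∀ P Q u v a b → a * a - P * b * a + Q * b * b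
        ≡ (a - b * u) * (a - b * v) + ((P - (u + v)) * - (b * a) + (Q - u * v) * (b * b))
      lemma = solve-∀

    at-u-homo : ∀ x y → mulQ P Q x y at u ≋ (x at u) * (y at u)
    at-u-homo (a , b) (c , d) =
      ≋-combination ((a - b * u) * (c - d * u)) (u * (b * d)) (- (b * d)) P≋ Q≋ (lemma P Q u v a b c d)
      where
      lemma : ∀ P Q u v a b c d → (a * c - Q * b * d) - (b * c + a * d - P * b * d) * u
        ≡ (a - b * u) * (c - d * u) + ((P - (u + v)) * (u * (b * d)) + (Q - u * v) * - (b * d))
      lemma = solve-∀

    unit⇒∤ : ∀ x → Unit x → (¬ (+ p) ∣ (x at u)) × (¬ (+ p) ∣ (x at v))
    unit⇒∤ x ux =
      (λ d → ux (≋0⇒∣ (≋-trans (Λ≋ x) (∣⇒≋0 {(x at u) * (x at v)} (∣-*ˡ (x at u) (x at v) d))))) ,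
      (λ d → ux (≋0⇒∣ (≋-trans (Λ≋ x) (≋-trans (≡⇒≋ (ℤ.*-comm (x at u) (x at v)))
        (∣⇒≋0 {(x at v) * (x at u)} (∣-*ˡ (x at v) (x at u) d))))))

    ∤⇒unit : ∀ x → ¬ (+ p) ∣ (x at u) → ¬ (+ p) ∣ (x at v) → Unit x
    ∤⇒unit x p∤u p∤v d = ∤-* (x at u) (x at v) p∤u p∤v (≋0⇒∣ (≋-trans (≋-sym (Λ≋ x)) (∣⇒≋0 {Λ P Q x} d)))

    p∤u : ¬ (+ p) ∣ u
    p∤u d = p∤Q (≋0⇒∣ (≋-trans (mk {Q} {u * v} (proj₂ factors)) (∣⇒≋0 {u * v} (∣-*ˡ u v d))))

    disc≋ : disc P Q ≋ (u - v) * (u - v)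
    disc≋ = ≋-combination ((u - v) * (u - v)) (P + u + v) (- + 4) P≋ Q≋ (lemma P Q u v)
      where
      lemma : ∀ P Q u v → P * P - + 4 * Q
        ≡ (u - v) * (u - v) + ((P - (u + v)) * (P + u + v) + (Q - u * v) * - + 4)
      lemma = solve-∀

  Factors-swap : ∀ {u v} → Factors P Q p u v → Factors P Q p v u
  Factors-swap {u} {v} (e₁ , e₂) =
    un (≋-trans (mk {P} {u + v} e₁) (≡⇒≋ (ℤ.+-comm u v))) ,
    un (≋-trans (mk {Q} {u * v} e₂) (≡⇒≋ (ℤ.*-comm u v)))

  -- Two distinct roots.

  module Distinct (u v : ℤ) (factors : Factors P Q p u v) (p∤D : ¬ (+ p) ∣ disc P Q) where
    open Roots u v factors
    open Roots v u (Factors-swap {u} {v} factors) using () renaming (at-u-homo to at-v-homo; p∤u to p∤v)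

    p∤u-v : ¬ (+ p) ∣ (u - v)
    p∤u-v d = p∤D (≋0⇒∣ (≋-trans disc≋ (∣⇒≋0 {(u - v) * (u - v)} (∣-*ˡ (u - v) (u - v) d))))

    φ : Pair → ℤ
    φ = φ2 p u v

    φ-* : ∀ x → Unit x → φ x * (x at v) ≋ x at u
    φ-* x ux = /-* (x at u) (x at v) (proj₂ (unit⇒∤ x ux))

    -- The factor `x at v` is a unit modulo p. So φ is pinned down by one linear equation, and the
    -- Fermat power inside `φ2` need not be expanded again.
    φ-unique : ∀ x t → Unit x → t * (x at v) ≋ x at u → φ x ≋ t
    φ-unique x t ux e = *-cancelʳ-≋ (x at v) (proj₂ (unit⇒∤ x ux)) (≋-trans (φ-* x ux) (≋-sym e))

    φ-valid : ∀ x → Unit x → ¬ (+ p) ∣ φ x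
    φ-valid x ux d = proj₁ (unit⇒∤ x ux) (≋0⇒∣ (≋-trans (≋-sym (φ-* x ux))
      (∣⇒≋0 {φ x * (x at v)} (∣-*ˡ (φ x) (x at v) d))))

    φ-cong : ∀ x y → Unit x → Unit y → x ∼ y → φ x ≋ φ y
    φ-cong x@(a , b) y@(c , d) ux uy ad≡bc =
      φ-unique x (φ y) ux (*-cancelʳ-≋ (y at v) (proj₂ (unit⇒∤ y uy)) (begin
        φ y * (x at v) * (y at v)    ≡⟨ swap (φ y) (x at v) (y at v) ⟩
        φ y * (y at v) * (x at v)    ≈⟨ *-cong (φ-* y uy) (≋-refl {x at v}) ⟩
        (y at u) * (x at v)          ≡⟨ cross ⟩
        (x at u) * (y at v)          ∎))
      where
      swap : ∀ s t w → s * t * w ≡ s * w * t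
      swap = solve-∀
      expand₁ : ∀ a b c d u v → (c - d * u) * (a - b * v) ≡ a * c - (b * c) * v - (a * d) * u + b * d * u * v
      expand₁ = solve-∀
      expand₂ : ∀ a b c d u v → a * c - (a * d) * v - (b * c) * u + b * d * u * v ≡ (a - b * u) * (c - d * v)
      expand₂ = solve-∀
      cross : (y at u) * (x at v) ≡ (x at u) * (y at v)
      cross = ≡.trans (expand₁ a b c d u v)
        (≡.trans (cong₂ (λ s t → a * c - s * v - t * u + b * d * u * v) (≡.sym ad≡bc) ad≡bc) (expand₂ a b c d u v))

    φ-homo : ∀ x y → Unit x → Unit y → φ (mulQ P Q x y) ≋ φ x * φ y
    φ-homo x y ux uy = φ-unique (mulQ P Q x y) (φ x * φ y) (unit-mulQ {x} {y} ux uy) (begin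
      φ x * φ y * (mulQ P Q x y at v)              ≈⟨ *-cong (≋-refl {φ x * φ y}) (at-v-homo x y) ⟩
      φ x * φ y * ((x at v) * (y at v))            ≡⟨ lemma (φ x) (φ y) (x at v) (y at v) ⟩
      (φ x * (x at v)) * (φ y * (y at v))          ≈⟨ *-cong (φ-* x ux) (φ-* y uy) ⟩
      (x at u) * (y at u)                          ≈⟨ at-u-homo x y ⟨
      mulQ P Q x y at u                            ∎)
      where
      lemma : ∀ s t a b → s * t * (a * b) ≡ (s * a) * (t * b)
      lemma = solve-∀

    φ-surj : ∀ t → ¬ (+ p) ∣ t → ∃[ x ] (Unit x × φ x ≋ t)
    φ-surj t p∤t = x , ux , φ-unique x t ux
        (≋-trans (*-cong (≋-refl {t}) (≡⇒≋ at-v)) (≡⇒≋ (≡.sym at-u)))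
      where
      w : ℤ
      w = v - u
      x : Pair
      -- Solves w₁ - w₀v = w and w₁ - w₀u = t w: the difference gives w₀(v - u) = (t - 1)w, and w =
      -- v - u clears the denominator.
      x = (w + (t - 1ℤ) * v , t - 1ℤ)
      lemma₁ : ∀ t u v → (v - u + (t - 1ℤ) * v) - (t - 1ℤ) * v ≡ v - u
      lemma₁ = solve-∀
      lemma₂ : ∀ t u v → (v - u + (t - 1ℤ) * v) - (t - 1ℤ) * u ≡ t * (v - u)
      lemma₂ = solve-∀
      at-v : x at v ≡ w
      at-v = lemma₁ t u v
      at-u : x at u ≡ t * w
      at-u = lemma₂ t u v
      p∤w : ¬ (+ p) ∣ w
      p∤w d = p∤u-v (subst (p ℕ.∣_) (ℤ.∣i-j∣≡∣j-i∣ v u) d)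
      ux : Unit x
      ux = ∤⇒unit x (λ d → ∤-* t w p∤t p∤w (subst ((+ p) ∣_) at-u d)) (λ d → p∤w (subst ((+ p) ∣_) at-v d))

    -- The values of x at u and at v differ by b(u - v) up to sign, and u - v is a unit because p ∤
    -- D.
    φ-ker : ∀ x → Unit x → (φ x ≋ 1ℤ) ⇔ (+ p) ∣ proj₂ x
    φ-ker x@(a , b) ux = mk⇔ fwd bwd
      where
      lemma : ∀ a b u v → (a - b * v) - (a - b * u) ≡ b * (u - v)
      lemma = solve-∀
      fwd : φ x ≋ 1ℤ → (+ p) ∣ b
      fwd e with p ℕ.∣? ∣ b ∣
      ... | yes d = d
      ... | no p∤b = ⊥-elim (∤-* b (u - v) p∤b p∤u-v (≋0⇒∣ (≋-trans (≡⇒≋ (≡.sym (lemma a b u v)))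
              (≋⇒-≋0 (begin
                x at v          ≡⟨ ℤ.*-identityˡ (x at v) ⟨
                1ℤ * (x at v)   ≈⟨ *-cong e (≋-refl {x at v}) ⟨
                φ x * (x at v)  ≈⟨ φ-* x ux ⟩
                x at u          ∎)))))
      bwd : (+ p) ∣ b → φ x ≋ 1ℤ
      bwd d = φ-unique x 1ℤ ux (≋-trans (≡⇒≋ (ℤ.*-identityˡ (x at v)))
        (-≋0⇒≋ (≋-trans (≡⇒≋ (lemma a b u v)) (∣⇒≋0 {b * (u - v)} (∣-*ˡ b (u - v) d)))))

    unitIso : UnitIso 𝔽ₚ× φ
    unitIso = record
      { isEquivalence = ≋-isEquivalence
      ; φ-valid = φ-valid ; φ-cong = φ-cong ; φ-homo = φ-homo ; φ-surj = φ-surj ; φ-ker = φ-ker }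

    h : ℤ
    h = u * inv p v

    hv≋u : h * v ≋ u
    hv≋u = /-* u v p∤v

    p∤h : ¬ (+ p) ∣ h
    p∤h d = p∤u (≋0⇒∣ (≋-trans (≋-sym hv≋u) (∣⇒≋0 {h * v} (∣-*ˡ h v d))))

    -- Modulo p, P - u is v and P - v is u, so `φ σ` is v / u while `h` is u / v.
    φσh≋1 : φ σ * h ≋ 1ℤ
    φσh≋1 = *-cancelʳ-≋ (v * u) (∤-* v u p∤v p∤u) (begin
      φ σ * h * (v * u)            ≡⟨ lemma (φ σ) h u v ⟩
      (h * v) * (φ σ * u)          ≈⟨ *-cong hv≋u (*-cong (≋-refl {φ σ}) (≋-sym σ-at-v)) ⟩
      u * (φ σ * (σ at v))         ≈⟨ *-cong (≋-refl {u}) (φ-* σ unit-σ) ⟩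
      u * (σ at u)                 ≈⟨ *-cong (≋-refl {u}) σ-at-u ⟩
      u * v                        ≡⟨ ≡.trans (ℤ.*-comm u v) (≡.sym (ℤ.*-identityˡ (v * u))) ⟩
      1ℤ * (v * u)                 ∎)
      where
      lemma : ∀ s h u v → s * h * (v * u) ≡ (h * v) * (s * u)
      lemma = solve-∀
      lemma-u : ∀ P u v → P - 1ℤ * u ≡ v + ((P - (u + v)) * 1ℤ + (P - (u + v)) * 0ℤ)
      lemma-u = solve-∀
      lemma-v : ∀ P u v → P - 1ℤ * v ≡ u + ((P - (u + v)) * 1ℤ + (P - (u + v)) * 0ℤ)
      lemma-v = solve-∀
      σ-at-u : σ at u ≋ v
      σ-at-u = ≋-combination v 1ℤ 0ℤ P≋ P≋ (lemma-u P u v)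
      σ-at-v : σ at v ≋ u
      σ-at-v = ≋-combination u 1ℤ 0ℤ P≋ P≋ (lemma-v P u v)

    -- Binet's formula with the denominator cleared. As p ∤ u - v, it makes p ∣ Fₖ equivalent to uᵏ
    -- = vᵏ, that is to hᵏ = 1, modulo p.
    lucas≋ : ∀ k → lucas P Q k * (u - v) ≋ u ^ k - v ^ k
    lucas≋ zero          = ≡⇒≋ ≡.refl
    lucas≋ (suc zero)    = ≡⇒≋ (lemma u v)
      where
      lemma : ∀ u v → 1ℤ * (u - v) ≡ u * 1ℤ - v * 1ℤ
      lemma = solve-∀
    lucas≋ (suc (suc k)) = begin
      (P * lucas P Q (suc k) - Q * lucas P Q k) * (u - v)
        ≡⟨ lemma₁ P Q (lucas P Q (suc k)) (lucas P Q k) (u - v) ⟩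
      P * (lucas P Q (suc k) * (u - v)) - Q * (lucas P Q k * (u - v))
        ≈⟨ sub-cong (*-cong (≋-refl {P}) (lucas≋ (suc k))) (*-cong (≋-refl {Q}) (lucas≋ k)) ⟩
      P * (u * u ^ k - v * v ^ k) - Q * (u ^ k - v ^ k)
        ≈⟨ ≋-combination (u * (u * u ^ k) - v * (v * v ^ k)) (u * u ^ k - v * v ^ k) (- (u ^ k - v ^ k)) P≋ Q≋
             (lemma₂ P Q u v (u ^ k) (v ^ k)) ⟩
      u * (u * u ^ k) - v * (v * v ^ k) ∎
      where
      lemma₁ : ∀ P Q l m w → (P * l - Q * m) * w ≡ P * (l * w) - Q * (m * w)
      lemma₁ = solve-∀
      lemma₂ : ∀ P Q u v U V → P * (u * U - v * V) - Q * (U - V)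
        ≡ u * (u * U) - v * (v * V) + ((P - (u + v)) * (u * U - v * V) + (Q - u * v) * - (U - V))
      lemma₂ = solve-∀

    hᵏvᵏ≋uᵏ : ∀ k → h ^ k * v ^ k ≋ u ^ k
    hᵏvᵏ≋uᵏ k = ≋-trans (≋-sym (×-distrib-+ h v k)) (^-cong k hv≋u)

    p∣lucas⇒h^≋1 : ∀ k → (+ p) ∣ lucas P Q k → h ^ k ≋ 1ℤ
    p∣lucas⇒h^≋1 k d = *-cancelʳ-≋ (v ^ k) (λ d′ → 𝔽.≉0-^ (∤⇒≋̸0 v p∤v) k (∣⇒≋0 {v ^ k} d′)) (begin
      h ^ k * v ^ k   ≈⟨ hᵏvᵏ≋uᵏ k ⟩
      u ^ k           ≈⟨ -≋0⇒≋ (≋-trans (≋-sym (lucas≋ k))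
                           (∣⇒≋0 {lucas P Q k * (u - v)} (∣-*ˡ (lucas P Q k) (u - v) d))) ⟩
      v ^ k           ≡⟨ ℤ.*-identityˡ (v ^ k) ⟨
      1ℤ * v ^ k      ∎)

    h^≋1⇒p∣lucas : ∀ k → h ^ k ≋ 1ℤ → (+ p) ∣ lucas P Q k
    h^≋1⇒p∣lucas k e with p ℕ.∣? ∣ lucas P Q k ∣
    ... | yes d = d
    ... | no p∤ = ⊥-elim (∤-* (lucas P Q k) (u - v) p∤ p∤u-v (≋0⇒∣ (≋-trans (lucas≋ k) (≋⇒-≋0 (begin
      u ^ k           ≈⟨ hᵏvᵏ≋uᵏ k ⟨
      h ^ k * v ^ k   ≈⟨ *-cong e (≋-refl {v ^ k}) ⟩
      1ℤ * v ^ k      ≡⟨ ℤ.*-identityˡ (v ^ k) ⟩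
      v ^ k           ∎)))))

    isoVia : IsoVia P Q (inK P Q p) _∼_ (inG P Q p) (T2 p) (φ2 p u v)
    isoVia = IsoVia-≈ {𝔽ₚ×} (λ s t → s ≡[ p ] t) (λ _ _ → un) (λ s t → mk {s} {t}) P Q (UnitIso.isoVia unitIso)

    isCyclic : CyclicOfOrder (T2 p) (p ∸ 1)
    isCyclic = let γ , generator , o = 𝔽ₚ×-generator in
      CyclicOfOrder-≈ {𝔽ₚ×} (λ s t → s ≡[ p ] t) (λ _ _ → un) (λ s t → mk {s} {t})
        (CyclicGroups.generator⇒CyclicOfOrder 𝔽ₚ×-laws generator 0<p-1 o)

    module _ {r : ℕ} .{{_ : NonZero r}} (rank : IsRank P Q p r) where

      h-order : HasOrder h r
      h-order = least⇒HasOrder (proj₁ rank) (p∣lucas⇒h^≋1 r (proj₁ (proj₂ rank)))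
        (λ m 0<m m<r e → proj₂ (proj₂ rank) m 0<m m<r (h^≋1⇒p∣lucas m e))

      ≈*⇔ : ∀ s t → TGrp._≈_ (T2* p u v) s t ⇔ (∃[ k ] s ≋ h ^ k * t)
      ≈*⇔ s t = mk⇔
        (λ (k , e) → k , ≋-trans (mk {s} {(h ℤ.^ k) * t} e) (≡⇒≋ (cong (λ y → y * t) (≡.sym (^≡ℤ^ h k)))))
        (λ (k , e) → k , un (≋-trans e (≡⇒≋ (cong (λ y → y * t) (^≡ℤ^ h k)))))

      ⟨h⟩-quotient : CyclicQuotient 𝔽ₚ×-laws
      ⟨h⟩-quotient = record
        { h = h ; h-valid = p∤h ; r = r ; 0<r = proj₁ rank ; h-order = h-order
        ; _≈*_ = TGrp._≈_ (T2* p u v) ; ≈*⇔ = ≈*⇔ }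

      isoVia* : IsoVia P Q (inK P Q p) (λ x y → x ≈π[ P , Q ] y) (inGstar P Q p) (T2* p u v) (φ2 p u v)
      isoVia* = Star.isoVia* unitIso ⟨h⟩-quotient φσh≋1

      isCyclic* : CyclicOfOrder (T2* p u v) ((p ∸ 1) / r)
      isCyclic* = let γ , generator , o = 𝔽ₚ×-generator in
        Quotient.CyclicOfOrder-quotient ⟨h⟩-quotient generator 0<p-1 o

  -- A double root.

  module Double (θ : ℤ) (factors : Factors P Q p θ θ) where
    open Roots θ θ factors

    𝔽ₚ⁺ : TGrp
    𝔽ₚ⁺ = record (T3 p) { _≈_ = _≋_ }

    φ : Pair → ℤ
    φ = φ3 p θ

    φ-* : ∀ x → Unit x → φ x * (x at θ) ≋ - proj₂ x
    φ-* x ux = /-* (- proj₂ x) (x at θ) (proj₁ (unit⇒∤ x ux))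

    φ-unique : ∀ x t → Unit x → t * (x at θ) ≋ - proj₂ x → φ x ≋ t
    φ-unique x t ux e = *-cancelʳ-≋ (x at θ) (proj₁ (unit⇒∤ x ux)) (≋-trans (φ-* x ux) (≋-sym e))

    φ-cong : ∀ x y → Unit x → Unit y → x ∼ y → φ x ≋ φ y
    φ-cong x@(a , b) y@(c , d) ux uy ad≡bc =
      φ-unique x (φ y) ux (*-cancelʳ-≋ (y at θ) (proj₁ (unit⇒∤ y uy)) (begin
        φ y * (x at θ) * (y at θ)    ≡⟨ swap (φ y) (x at θ) (y at θ) ⟩
        φ y * (y at θ) * (x at θ)    ≈⟨ *-cong (φ-* y uy) (≋-refl {x at θ}) ⟩
        - d * (a - b * θ)            ≡⟨ expand₁ a b d θ ⟩
        - (a * d) + b * d * θ        ≡⟨ cong (λ s → - s + b * d * θ) ad≡bc ⟩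
        - (b * c) + b * d * θ        ≡⟨ expand₂ b c d θ ⟩
        - b * (y at θ)               ∎))
      where
      swap : ∀ s t w → s * t * w ≡ s * w * t
      swap = solve-∀
      expand₁ : ∀ a b d t → - d * (a - b * t) ≡ - (a * d) + b * d * t
      expand₁ = solve-∀
      expand₂ : ∀ b c d t → - (b * c) + b * d * t ≡ - b * (c - d * t)
      expand₂ = solve-∀

    -- With ε = t - θ in 𝔽ₚ[t]/(t - θ)², w₁ - w₀t equals (w₁ - w₀θ)(1 + φ ε). Since ε² = 0,
    -- multiplying such elements adds the coefficients φ.
    φ-homo : ∀ x y → Unit x → Unit y → φ (mulQ P Q x y) ≋ φ x + φ y
    φ-homo x@(a , b) y@(c , d) ux uy = φ-unique (mulQ P Q x y) (φ x + φ y) (unit-mulQ {x} {y} ux uy) (begin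
      (φ x + φ y) * (mulQ P Q x y at θ)          ≈⟨ *-cong (≋-refl {φ x + φ y}) (at-u-homo x y) ⟩
      (φ x + φ y) * ((x at θ) * (y at θ))        ≡⟨ lemma₁ (φ x) (φ y) (x at θ) (y at θ) ⟩
      φ x * (x at θ) * (y at θ) + φ y * (y at θ) * (x at θ)
        ≈⟨ +-cong (*-cong (φ-* x ux) (≋-refl {y at θ})) (*-cong (φ-* y uy) (≋-refl {x at θ})) ⟩
      - b * (y at θ) + - d * (x at θ)
        ≈⟨ ≋-combination (- (b * c + a * d - P * b * d)) (- (b * d)) 0ℤ P≋ P≋ (lemma₂ P a b c d θ) ⟩
      - (b * c + a * d - P * b * d)              ∎)
      where
      lemma₁ : ∀ s t a b → (s + t) * (a * b) ≡ s * a * b + t * b * a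
      lemma₁ = solve-∀
      lemma₂ : ∀ P a b c d t → - b * (c - d * t) + - d * (a - b * t)
        ≡ - (b * c + a * d - P * b * d) + ((P - (t + t)) * - (b * d) + (P - (t + t)) * 0ℤ)
      lemma₂ = solve-∀

    φ-surj : ∀ t → ∃[ x ] (Unit x × φ x ≋ t)
    φ-surj t = x , ux , φ-unique x t ux (≡⇒≋ (≡.trans (cong (λ s → t * s) x-at-θ) (lemma₂ t)))
      where
      x : Pair
      -- This pair encodes 1 + t ε, with ε the nilpotent of the double root; its value at θ is 1.
      x = (1ℤ - t * θ , - t)
      lemma₁ : ∀ t u → (1ℤ - t * u) - (- t) * u ≡ 1ℤ
      lemma₁ = solve-∀
      lemma₂ : ∀ t → t * 1ℤ ≡ - - t
      lemma₂ = solve-∀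
      x-at-θ : x at θ ≡ 1ℤ
      x-at-θ = lemma₁ t θ
      p∤ : ¬ (+ p) ∣ (x at θ)
      p∤ d = 1≋̸0 (∣⇒≋0 (subst ((+ p) ∣_) x-at-θ d))
      ux : Unit x
      ux = ∤⇒unit x p∤ p∤

    φ-ker : ∀ x → Unit x → (φ x ≋ 0ℤ) ⇔ (+ p) ∣ proj₂ x
    φ-ker x@(a , b) ux = mk⇔
      (λ e → ≋0⇒∣ (begin
        b                       ≡⟨ ℤ.neg-involutive b ⟨
        - - b                   ≈⟨ -‿cong (φ-* x ux) ⟨
        - (φ x * (x at θ))      ≈⟨ -‿cong (*-cong e (≋-refl {x at θ})) ⟩
        - (0ℤ * (x at θ))       ≡⟨ lemma (x at θ) ⟩
        0ℤ                      ∎))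
      (λ d → φ-unique x 0ℤ ux (begin
        0ℤ * (x at θ)           ≡⟨ ℤ.*-zeroˡ (x at θ) ⟩
        - 0ℤ                    ≈⟨ -‿cong (∣⇒≋0 {b} d) ⟨
        - b                     ∎))
      where
      lemma : ∀ s → - (0ℤ * s) ≡ 0ℤ
      lemma = solve-∀

    unitIso : UnitIso 𝔽ₚ⁺ φ
    unitIso = record
      { isEquivalence = ≋-isEquivalence
      ; φ-valid = λ _ _ → tt ; φ-cong = φ-cong ; φ-homo = φ-homo ; φ-surj = λ t _ → φ-surj t ; φ-ker = φ-ker }

    isoVia : IsoVia P Q (inK P Q p) _∼_ (inG P Q p) (T3 p) (φ3 p θ)
    isoVia = IsoVia-≈ {𝔽ₚ⁺} (λ s t → s ≡[ p ] t) (λ _ _ → un) (λ s t → mk {s} {t}) P Q (UnitIso.isoVia unitIso)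

    φ-shiftPow : ∀ m → φ (shiftPow P Q m) ≋ + m * φ σ
    φ-shiftPow zero    = UnitIso.φ-1 unitIso
    φ-shiftPow (suc m) = begin
      φ (mulQ P Q σ (shiftPow P Q m))    ≈⟨ φ-homo σ (shiftPow P Q m) unit-σ (unit-shiftPow m) ⟩
      φ σ + φ (shiftPow P Q m)           ≈⟨ +-cong (≋-refl {φ σ}) (φ-shiftPow m) ⟩
      φ σ + + m * φ σ                    ≡⟨ ℤ.suc-* (+ m) (φ σ) ⟨
      + suc m * φ σ                      ∎

    -- [P:1] maps to a nonzero element of 𝔽ₚ, whose multiples exhaust 𝔽ₚ.
    K⊆G* : ∀ x → inK P Q p x → inGstar P Q p x
    K⊆G* x (_ , ux) = shift-into-G unitIso x m ux (begin
      φ (mulQ P Q x (shiftPow P Q m))        ≈⟨ φ-homo x (shiftPow P Q m) ux (unit-shiftPow m) ⟩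
      φ x + φ (shiftPow P Q m)               ≈⟨ +-cong (≋-refl {φ x}) (φ-shiftPow m) ⟩
      φ x + + m * φ σ                        ≈⟨ +-cong (≋-refl {φ x}) (*-cong (%≋ (- φ x * inv p (φ σ))) (≋-refl {φ σ})) ⟨
      φ x + - φ x * inv p (φ σ) * φ σ        ≈⟨ +-cong (≋-refl {φ x}) (/-* (- φ x) (φ σ) p∤φσ) ⟩
      φ x + - φ x                            ≡⟨ ℤ.+-inverseʳ (φ x) ⟩
      0ℤ                                     ∎)
      where
      m : ℕ
      m = (- φ x * inv p (φ σ)) %ℕ p
      -- If `φ σ` were 0 modulo p, `φ-ker` would make p divide 1, the second entry of σ.
      p∤φσ : ¬ (+ p) ∣ φ σ
      p∤φσ d = 1≋̸0 (∣⇒≋0 (to (φ-ker σ unit-σ) (∣⇒≋0 {φ σ} d)))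

  -- D is (u - v)² modulo p, so the two roots coincide.
  p∣disc⇒double-root : ∀ u v → Factors P Q p u v → (+ p) ∣ disc P Q → Factors P Q p u u
  p∣disc⇒double-root u v factors p∣D =
    un (≋-trans (mk {P} {u + v} (proj₁ factors)) (+-cong (≋-refl {u}) v≋u)) ,
    un (≋-trans (mk {Q} {u * v} (proj₂ factors)) (*-cong (≋-refl {u}) v≋u))
    where
    u-v≋0 : u - v ≋ 0ℤ
    u-v≋0 = [ (λ e → e) , (λ e → e) ]′ (noZeroDivisors (u - v) (u - v)
      (≋-trans (≋-sym (Roots.disc≋ u v factors)) (∣⇒≋0 {disc P Q} p∣D)))
    v≋u : v ≋ u
    v≋u = ≋-sym (-≋0⇒≋ u-v≋0)

-- Irreducible f modulo p: the field 𝔽ₚ[θ].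

module Inert (P Q : ℤ) {p : ℕ} (p-prime : Prime p) (p∤Q : ¬ (+ p) ∣ Q) (irreducible : Irreducible P Q p) where
  open PrimeModulus p-prime
  open PrimeField p-prime using (inv-*)
  open Classes P Q p-prime p∤Q

  infix 4 _≋₂_
  _≋₂_ : Pair → Pair → Set
  (a , b) ≋₂ (c , d) = (a ≋ c) × (b ≋ d)

  infixl 7 _·_
  _·_ : Pair → Pair → Pair
  _·_ = mulF P Q

  ≡⇒≋₂ : ∀ {x y} → x ≡ y → x ≋₂ y
  ≡⇒≋₂ ≡.refl = ≋-refl , ≋-refl

  ·-cong : ∀ x x′ y y′ → x ≋₂ x′ → y ≋₂ y′ → x · y ≋₂ x′ · y′
  ·-cong _ _ _ _ (a≋ , b≋) (c≋ , d≋) =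
    sub-cong (*-cong a≋ c≋) (*-cong (*-cong (≋-refl {Q}) b≋) d≋) ,
    +-cong (+-cong (*-cong a≋ d≋) (*-cong b≋ c≋)) (*-cong (*-cong (≋-refl {P}) b≋) d≋)

  ·-assoc : ∀ x y z → (x · y) · z ≡ x · (y · z)
  ·-assoc (a , b) (c , d) (s , t) = cong₂ _,_ (lemma₁ P Q a b c d s t) (lemma₂ P Q a b c d s t)
    where
    lemma₁ : ∀ P Q a b c d s t →
      (a * c - Q * b * d) * s - Q * (a * d + b * c + P * b * d) * t
      ≡ a * (c * s - Q * d * t) - Q * b * (c * t + d * s + P * d * t)
    lemma₁ = solve-∀
    lemma₂ : ∀ P Q a b c d s t →
      (a * c - Q * b * d) * t + (a * d + b * c + P * b * d) * s + P * (a * d + b * c + P * b * d) * t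
      ≡ a * (c * t + d * s + P * d * t) + b * (c * s - Q * d * t) + P * b * (c * t + d * s + P * d * t)
    lemma₂ = solve-∀

  ·-comm : ∀ x y → x · y ≡ y · x
  ·-comm (a , b) (c , d) = cong₂ _,_ (lemma₁ Q a b c d) (lemma₂ P a b c d)
    where
    lemma₁ : ∀ Q a b c d → a * c - Q * b * d ≡ c * a - Q * d * b
    lemma₁ = solve-∀
    lemma₂ : ∀ P a b c d → a * d + b * c + P * b * d ≡ c * b + d * a + P * d * b
    lemma₂ = solve-∀

  1₂ : Pair
  1₂ = (1ℤ , 0ℤ)

  ·-identityˡ : ∀ x → 1₂ · x ≡ x
  ·-identityˡ (a , b) = cong₂ _,_ (lemma₁ Q a b) (lemma₂ P a b)
    where
    lemma₁ : ∀ Q a b → 1ℤ * a - Q * 0ℤ * b ≡ a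
    lemma₁ = solve-∀
    lemma₂ : ∀ P a b → 1ℤ * b + 0ℤ * a + P * 0ℤ * b ≡ b
    lemma₂ = solve-∀

  ·-identityʳ : ∀ x → x · 1₂ ≡ x
  ·-identityʳ x = ≡.trans (·-comm x 1₂) (·-identityˡ x)

  _⊕_ : Pair → Pair → Pair
  (a , b) ⊕ (c , d) = (a + c , b + d)

  ·-distribˡ : ∀ x y z → x · (y ⊕ z) ≡ (x · y) ⊕ (x · z)
  ·-distribˡ (a , b) (c , d) (s , t) = cong₂ _,_ (lemma₁ Q a b c d s t) (lemma₂ P a b c d s t)
    where
    lemma₁ : ∀ Q a b c d s t → a * (c + s) - Q * b * (d + t) ≡ (a * c - Q * b * d) + (a * s - Q * b * t)
    lemma₁ = solve-∀
    lemma₂ : ∀ P a b c d s t → a * (d + t) + b * (c + s) + P * b * (d + t)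
      ≡ (a * d + b * c + P * b * d) + (a * t + b * s + P * b * t)
    lemma₂ = solve-∀

  ·-distribʳ : ∀ x y z → (y ⊕ z) · x ≡ (y · x) ⊕ (z · x)
  ·-distribʳ x y z = ≡.trans (·-comm (y ⊕ z) x)
    (≡.trans (·-distribˡ x y z) (cong₂ _⊕_ (·-comm x y) (·-comm x z)))

  𝔽ₚ[θ] : CommutativeRing 0ℓ 0ℓ
  𝔽ₚ[θ] = record
    { Carrier = Pair ; _≈_ = _≋₂_ ; _+_ = _⊕_ ; _*_ = _·_ ; -_ = λ (a , b) → (- a , - b)
    ; 0# = (0ℤ , 0ℤ) ; 1# = 1₂
    ; isCommutativeRing = record
      { isRing = record
        { +-isAbelianGroup = record
          { isGroup = record
            { isMonoid = record
              { isSemigroup = record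
                { isMagma = record
                  { isEquivalence = record
                    { refl = ≋-refl , ≋-refl
                    ; sym = λ (e , f) → ≋-sym e , ≋-sym f
                    ; trans = λ (e , f) (e′ , f′) → ≋-trans e e′ , ≋-trans f f′ }
                  ; ∙-cong = λ (e , f) (e′ , f′) → +-cong e e′ , +-cong f f′ }
                ; assoc = λ (a , b) (c , d) (s , t) → ≡⇒≋ (ℤ.+-assoc a c s) , ≡⇒≋ (ℤ.+-assoc b d t) }
              ; identity = (λ (a , b) → ≡⇒≋ (ℤ.+-identityˡ a) , ≡⇒≋ (ℤ.+-identityˡ b))
                         , (λ (a , b) → ≡⇒≋ (ℤ.+-identityʳ a) , ≡⇒≋ (ℤ.+-identityʳ b)) }
            ; inverse = (λ (a , b) → ≡⇒≋ (ℤ.+-inverseˡ a) , ≡⇒≋ (ℤ.+-inverseˡ b))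
                      , (λ (a , b) → ≡⇒≋ (ℤ.+-inverseʳ a) , ≡⇒≋ (ℤ.+-inverseʳ b))
            ; ⁻¹-cong = λ (e , f) → -‿cong e , -‿cong f }
          ; comm = λ (a , b) (c , d) → ≡⇒≋ (ℤ.+-comm a c) , ≡⇒≋ (ℤ.+-comm b d) }
        ; *-cong = λ {x} {x′} {y} {y′} → ·-cong x x′ y y′
        ; *-assoc = λ x y z → ≡⇒≋₂ (·-assoc x y z)
        ; *-identity = (λ x → ≡⇒≋₂ (·-identityˡ x)) , (λ x → ≡⇒≋₂ (·-identityʳ x))
        ; distrib = (λ x y z → ≡⇒≋₂ (·-distribˡ x y z)) , (λ x y z → ≡⇒≋₂ (·-distribʳ x y z)) }
      ; *-comm = λ x y → ≡⇒≋₂ (·-comm x y) } }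

  -- If b ≢ 0, then a / b would be a root of f mod p.
  Λ≋0⇒≋0 : ∀ a b → Λ P Q (a , b) ≋ 0ℤ → (a , b) ≋₂ (0ℤ , 0ℤ)
  Λ≋0⇒≋0 a b Λ≋0 with b ≋? 0ℤ
  ... | yes b≋0 = [ (λ e → e) , (λ e → e) ]′ (noZeroDivisors a a (≋-trans (≋-sym (b≋0⇒Λ≋a² a b b≋0)) Λ≋0)) , b≋0
  -- t and P - t multiply to Q - f(t), and f(t) = Λ(t, 1) vanishes because (t, 1) is b⁻¹(a, b)
  -- modulo p.
  ... | no b≋̸0 = ⊥-elim (irreducible (t , P - t , un (≡⇒≋ (lemma₁ P t)) , un Q≋))
    where
    open import Relation.Binary.Reasoning.Setoid (CommutativeRing.setoid ℤ/n)
    i t : ℤ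
    i = inv p b
    t = a * i
    bi≋1 : b * i ≋ 1ℤ
    bi≋1 = inv-* b (λ d → b≋̸0 (∣⇒≋0 {b} d))
    lemma₁ : ∀ P t → P ≡ t + (P - t)
    lemma₁ = solve-∀
    lemma₂ : ∀ P Q t → Q ≡ t * (P - t) + (t * t - P * 1ℤ * t + Q * 1ℤ * 1ℤ)
    lemma₂ = solve-∀
    Q≋ : Q ≋ t * (P - t)
    Q≋ = begin
      Q                                                            ≡⟨ lemma₂ P Q t ⟩
      t * (P - t) + (t * t - P * 1ℤ * t + Q * 1ℤ * 1ℤ)             ≈⟨ +-cong (≋-refl {t * (P - t)}) (+-cong
        (sub-cong (≋-refl {t * t}) (*-cong (*-cong (≋-refl {P}) bi≋1) (≋-refl {t}))) (*-cong (*-cong (≋-refl {Q}) bi≋1) bi≋1)) ⟨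
      t * (P - t) + Λ P Q (a * i , b * i)                          ≡⟨ cong (λ s → t * (P - t) + s) (Λ-scale P Q a b i) ⟩
      t * (P - t) + Λ P Q (a , b) * (i * i)                        ≈⟨ +-cong (≋-refl {t * (P - t)}) (*-cong Λ≋0 (≋-refl {i * i})) ⟩
      t * (P - t) + 0ℤ * (i * i)                                   ≡⟨ ≡.trans (cong (λ s → t * (P - t) + s) (ℤ.*-zeroˡ (i * i))) (ℤ.+-identityʳ (t * (P - t))) ⟩
      t * (P - t)                                                  ∎

  φ1-homo : ∀ x y → φ1 (mulQ P Q x y) ≡ φ1 x · φ1 y
  φ1-homo (a , b) (c , d) = cong₂ _,_ (lemma₁ Q a b c d) (lemma₂ P a b c d)
    where
    lemma₁ : ∀ Q a b c d → a * c - Q * b * d ≡ a * c - Q * (- b) * (- d)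
    lemma₁ = solve-∀
    lemma₂ : ∀ P a b c d → - (b * c + a * d - P * b * d) ≡ a * (- d) + (- b) * c + P * (- b) * (- d)
    lemma₂ = solve-∀

  φ1-involutive : ∀ x → φ1 (φ1 x) ≡ x
  φ1-involutive (a , b) = cong (λ s → a , s) (ℤ.neg-involutive b)

  -- This is a² + P a b + Q b², the norm of a + bθ; `Λ` itself is the norm of w₁ - w₀θ, whence the
  -- sign change by `φ1`.
  norm : Pair → ℤ
  norm x = Λ P Q (φ1 x)

  norm-· : ∀ x y → norm (x · y) ≡ norm x * norm y
  norm-· x y = ≡.trans (cong (Λ P Q) (≡.trans (cong φ1 (≡.trans
      (cong₂ _·_ (≡.sym (φ1-involutive x)) (≡.sym (φ1-involutive y))) (≡.sym (φ1-homo (φ1 x) (φ1 y)))))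
      (φ1-involutive _)))
    (Λ-mulQ P Q (φ1 x) (φ1 y))

  norm≋0⇒≋0 : ∀ x → norm x ≋ 0ℤ → x ≋₂ (0ℤ , 0ℤ)
  norm≋0⇒≋0 (a , b) e = let a≋0 , -b≋0 = Λ≋0⇒≋0 a (- b) e in
    a≋0 , ≋-trans (≡⇒≋ (≡.sym (ℤ.neg-involutive b))) (-‿cong -b≋0)

  ≋0⇒norm≋0 : ∀ x → x ≋₂ (0ℤ , 0ℤ) → norm x ≋ 0ℤ
  ≋0⇒norm≋0 (a , b) (a≋0 , b≋0) = ≋0⇒Λ≋0 a (- b) a≋0 (-‿cong b≋0)

  -- The norm is multiplicative and, f being irreducible, vanishes modulo p only at 0; so the
  -- question reduces to the prime field.
  noZeroDivisors₂ : ∀ x y → x · y ≋₂ (0ℤ , 0ℤ) → x ≋₂ (0ℤ , 0ℤ) ⊎ y ≋₂ (0ℤ , 0ℤ)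
  noZeroDivisors₂ x y e = Sum.map (norm≋0⇒≋0 x) (norm≋0⇒≋0 y) (noZeroDivisors (norm x) (norm y)
    (≋-trans (≡⇒≋ (≡.sym (norm-· x y))) (≋0⇒norm≋0 (x · y) e)))

  _≋₂?_ : ∀ x y → Dec (x ≋₂ y)
  (a , b) ≋₂? (c , d) = (a ≋? c) ×-dec (b ≋? d)

  residue² : Fin p × Fin p → Pair
  residue² (i , j) = residue i , residue j

  residue₂ : Fin (p ℕ.* p) → Pair
  residue₂ k = residue² (Fin.remQuot {p} p k)

  residue₂-surjective : ∀ x → ∃[ k ] residue₂ k ≋₂ x
  residue₂-surjective (a , b) = let i , i≋a = residue-surjective a
                                    j , j≋b = residue-surjective b
    in Fin.combine i j , subst (_≋₂ (a , b)) (cong residue² (≡.sym (Fin.remQuot-combine {p} {p} i j))) (i≋a , j≋b)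

  𝔽ₚ[θ]-finiteDomain : FiniteDomain 𝔽ₚ[θ]
  𝔽ₚ[θ]-finiteDomain = record
    { _≟_ = _≋₂?_ ; noZeroDivisors = noZeroDivisors₂ ; 1≉0 = λ (e , _) → 1≋̸0 e
    ; rep = residue₂ ; rep-surjective = residue₂-surjective }

  module 𝔽² = UnitsOfFiniteDomain 𝔽ₚ[θ]-finiteDomain

  -- Pairs up to scalars and the projective line.

  infixr 7 _⊙_
  _⊙_ : ℤ → Pair → Pair
  l ⊙ (a , b) = (l * a , l * b)

  infix 4 _≈₁_
  record _≈₁_ (x y : Pair) : Set where
    constructor scaled
    field
      scalar   : ℤ
      p∤scalar : ¬ (+ p) ∣ scalar
      scales   : x ≋₂ scalar ⊙ y

  open CommutativeRing 𝔽ₚ[θ] using (*-commutativeMonoid) renaming (refl to ≋₂-refl; sym to ≋₂-sym; trans to ≋₂-trans)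

  ⊙-cong : ∀ l x y → x ≋₂ y → l ⊙ x ≋₂ l ⊙ y
  ⊙-cong l x y (e , f) = *-cong (≋-refl {l}) e , *-cong (≋-refl {l}) f

  ⊙-assoc : ∀ l m x → l ⊙ (m ⊙ x) ≡ (l * m) ⊙ x
  ⊙-assoc l m (a , b) = cong₂ _,_ (≡.sym (ℤ.*-assoc l m a)) (≡.sym (ℤ.*-assoc l m b))

  1⊙ : ∀ {l} x → l ≋ 1ℤ → l ⊙ x ≋₂ x
  1⊙ (a , b) e = ≋-trans (*-cong e (≋-refl {a})) (≡⇒≋ (ℤ.*-identityˡ a))
               , ≋-trans (*-cong e (≋-refl {b})) (≡⇒≋ (ℤ.*-identityˡ b))

  ⊙-· : ∀ l m x y → (l ⊙ x) · (m ⊙ y) ≡ (l * m) ⊙ (x · y)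
  ⊙-· l m (a , b) (c , d) = cong₂ _,_ (lemma₁ Q l m a b c d) (lemma₂ P l m a b c d)
    where
    lemma₁ : ∀ Q l m a b c d → (l * a) * (m * c) - Q * (l * b) * (m * d) ≡ l * m * (a * c - Q * b * d)
    lemma₁ = solve-∀
    lemma₂ : ∀ P l m a b c d → (l * a) * (m * d) + (l * b) * (m * c) + P * (l * b) * (m * d)
      ≡ l * m * (a * d + b * c + P * b * d)
    lemma₂ = solve-∀

  ∤1 : ¬ (+ p) ∣ 1ℤ
  ∤1 d = 1≋̸0 (∣⇒≋0 {1ℤ} d)

  ∤inv : ∀ l → ¬ (+ p) ∣ l → ¬ (+ p) ∣ inv p l
  ∤inv l p∤l d = 1≋̸0 (≋-trans (≋-sym (inv-* l p∤l)) (≋-trans (≡⇒≋ (ℤ.*-comm l (inv p l)))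
    (∣⇒≋0 {inv p l * l} (∣-*ˡ (inv p l) l d))))

  ≋₂⇒≈₁ : ∀ {x y} → x ≋₂ y → x ≈₁ y
  ≋₂⇒≈₁ {x} {y} e = scaled 1ℤ ∤1 (≋₂-trans {x} {y} {1ℤ ⊙ y} e (≋₂-sym {1ℤ ⊙ y} {y} (1⊙ y ≋-refl)))

  ≡⇒≈₁ : ∀ {x y} → x ≡ y → x ≈₁ y
  ≡⇒≈₁ {x} ≡.refl = ≋₂⇒≈₁ {x} {x} (≋₂-refl {x})

  ≈₁-sym : ∀ {x y} → x ≈₁ y → y ≈₁ x
  ≈₁-sym {x} {y} (scaled l p∤l e) = scaled i (∤inv l p∤l) (≋₂-trans {y} {(i * l) ⊙ y} {i ⊙ x}
      (≋₂-sym {(i * l) ⊙ y} {y} (1⊙ y (≋-trans (≡⇒≋ (ℤ.*-comm i l)) (inv-* l p∤l))))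
      (≋₂-trans {(i * l) ⊙ y} {i ⊙ (l ⊙ y)} {i ⊙ x} (≡⇒≋₂ (≡.sym (⊙-assoc i l y)))
        (⊙-cong i (l ⊙ y) x (≋₂-sym {x} {l ⊙ y} e))))
    where
    i : ℤ
    i = inv p l

  ≈₁-trans : ∀ {x y z} → x ≈₁ y → y ≈₁ z → x ≈₁ z
  ≈₁-trans {x} {y} {z} (scaled l p∤l e) (scaled m p∤m f) = scaled (l * m) (∤-* l m p∤l p∤m)
    (≋₂-trans {x} {l ⊙ y} {(l * m) ⊙ z} e (≋₂-trans {l ⊙ y} {l ⊙ (m ⊙ z)} {(l * m) ⊙ z}
      (⊙-cong l y (m ⊙ z) f) (≡⇒≋₂ (⊙-assoc l m z))))

  ≈₁-·-cong : ∀ {x x′ y y′} → x ≈₁ x′ → y ≈₁ y′ → x · y ≈₁ x′ · y′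
  ≈₁-·-cong {x} {x′} {y} {y′} (scaled l p∤l e) (scaled m p∤m f) = scaled (l * m) (∤-* l m p∤l p∤m)
    (≋₂-trans {x · y} {(l ⊙ x′) · (m ⊙ y′)} {(l * m) ⊙ (x′ · y′)}
      (·-cong x (l ⊙ x′) y (m ⊙ y′) e f) (≡⇒≋₂ (⊙-· l m x′ y′)))

  𝔽ₚ[θ]×/𝔽ₚ× : TGrp
  𝔽ₚ[θ]×/𝔽ₚ× = record (T1 P Q p) { _≈_ = _≈₁_ }

  Valid : Pair → Set
  Valid = TGrp.Valid 𝔽ₚ[θ]×/𝔽ₚ×

  valid⇒≋̸0 : ∀ x → Valid x → ¬ x ≋₂ (0ℤ , 0ℤ)
  valid⇒≋̸0 (a , b) v (e , f) = v (≋0⇒∣ e , ≋0⇒∣ f)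

  ≋̸0⇒valid : ∀ x → ¬ x ≋₂ (0ℤ , 0ℤ) → Valid x
  ≋̸0⇒valid (a , b) ≋̸0 (d , d′) = ≋̸0 (∣⇒≋0 {a} d , ∣⇒≋0 {b} d′)

  laws : Laws 𝔽ₚ[θ]×/𝔽ₚ×
  laws = record
    { isCommutativeMonoid = record
      { isMonoid = record
        { isSemigroup = record
          { isMagma = record
            { isEquivalence = record { refl = ≡⇒≈₁ ≡.refl ; sym = ≈₁-sym ; trans = ≈₁-trans }
            ; ∙-cong = ≈₁-·-cong }
          ; assoc = λ x y z → ≡⇒≈₁ (·-assoc x y z) }
        ; identity = (λ x → ≡⇒≈₁ (·-identityˡ x)) , (λ x → ≡⇒≈₁ (·-identityʳ x)) }
      ; comm = λ x y → ≡⇒≈₁ (·-comm x y) }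
    ; e-valid = λ (d , _) → ∤1 d
    ; ·-valid = λ {x} {y} vx vy → ≋̸0⇒valid (x · y) (𝔽².≉0-* {x} {y} (valid⇒≋̸0 x vx) (valid⇒≋̸0 y vy)) }

  open Orders (Laws.commutativeMonoid laws)
  open CyclicGroups laws

  ^≡^ : ∀ x k → x ^ k ≡ Orders._^_ *-commutativeMonoid x k
  ^≡^ x zero    = ≡.refl
  ^≡^ x (suc k) = cong (x ·_) (^≡^ x k)

  -- An element is a scalar when its θ-coordinate vanishes, and validity makes that scalar nonzero.
  -- The test decides triviality of powers and later ties powers of θ to Lucas numbers.
  ≈₁1⇔ : ∀ x → Valid x → (x ≈₁ 1₂) ⇔ (+ p) ∣ proj₂ x
  ≈₁1⇔ (a , b) v = mk⇔
    (λ { (scaled l _ (_ , e)) → ≋0⇒∣ (≋-trans e (≡⇒≋ (ℤ.*-zeroʳ l))) })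
    (λ d → scaled a (λ d′ → v (d′ , d)) (≡⇒≋ (≡.sym (ℤ.*-identityʳ a)) , ≋-trans (∣⇒≋0 {b} d) (≡⇒≋ (≡.sym (ℤ.*-zeroʳ a)))))

  -- The projective line over 𝔽ₚ: [1:0] and the points [i:1], p + 1 in all.
  point : Fin (suc p) → Pair
  point fzero    = 1₂
  point (fsuc i) = residue i , 1ℤ

  point-valid : ∀ i → Valid (point i)
  point-valid fzero    (d , _) = ∤1 d
  point-valid (fsuc i) (_ , d) = ∤1 d

  point-injective : ∀ i j → point i ≈₁ point j → i ≡ j
  point-injective fzero    fzero    _ = ≡.refl
  point-injective fzero    (fsuc j) (scaled l p∤l (_ , e)) =
    ⊥-elim (p∤l (≋0⇒∣ (≋-trans (≡⇒≋ (≡.sym (ℤ.*-identityʳ l))) (≋-sym e))))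
  point-injective (fsuc i) fzero    (scaled l p∤l (_ , e)) = ⊥-elim (1≋̸0 (≋-trans e (≡⇒≋ (ℤ.*-zeroʳ l))))
  point-injective (fsuc i) (fsuc j) (scaled l p∤l (e , f)) = cong fsuc (residue-injective i j
    (≋-trans e (≋-trans (*-cong (≋-trans (≡⇒≋ (≡.sym (ℤ.*-identityʳ l))) (≋-sym f)) (≋-refl {residue j}))
      (≡⇒≋ (ℤ.*-identityˡ (residue j))))))

  point-surjective : ∀ x → Valid x → ∃[ i ] point i ≈₁ x
  point-surjective x@(a , b) v with p ℕ.∣? ∣ b ∣
  ... | yes d = fzero , ≈₁-sym (from (≈₁1⇔ x v) d)
  ... | no p∤b = let j , j≋ = residue-surjective (inv p b * a) in
    fsuc j , scaled (inv p b) (∤inv b p∤b) (j≋ , ≋-sym (≋-trans (≡⇒≋ (ℤ.*-comm (inv p b) b)) (inv-* b p∤b)))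

  module _ {γ : Pair} (γ≋̸0 : ¬ γ ≋₂ (0ℤ , 0ℤ))
    (γ-generates : ∀ x → ¬ x ≋₂ (0ℤ , 0ℤ) → ∃[ i ] Orders._^_ *-commutativeMonoid γ i ≋₂ x) where

    generates⇒Generator : Generator γ
    generates⇒Generator = ≋̸0⇒valid γ γ≋̸0 , λ t v →
      let i , e = γ-generates t (valid⇒≋̸0 t v) in i , ≈₁-trans (≡⇒≈₁ (^≡^ γ i)) (≋₂⇒≈₁ e)

    ^≈1? : ∀ k → Dec (γ ^ k ≈₁ 1₂)
    ^≈1? k = map′ (from γᵏ≈1⇔) (to γᵏ≈1⇔) (p ℕ.∣? ∣ proj₂ (γ ^ k) ∣)
      where
      γᵏ≈1⇔ : (γ ^ k ≈₁ 1₂) ⇔ (+ p) ∣ proj₂ (γ ^ k)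
      γᵏ≈1⇔ = ≈₁1⇔ (γ ^ k) (^-valid {γ} (≋̸0⇒valid γ γ≋̸0) k)

    -- A positive exponent comes from the finite order of γ in 𝔽ₚ[θ]^×; the exact order in the
    -- quotient is then the number of classes, counted by `point`.
    generates⇒order : HasOrder γ (p ℕ.+ 1)
    generates⇒order = exact (HasOrder-exists {γ} ^≈1? (proj₁ finite) (proj₁ (proj₂ finite))
        (≈₁-trans (≡⇒≈₁ (^≡^ γ (proj₁ finite))) (≋₂⇒≈₁ (proj₂ (proj₂ finite)))))
      where
      finite : ∃[ k ] (0 < k × Orders._^_ *-commutativeMonoid γ k ≋₂ 1₂)
      finite = 𝔽².≉0⇒^≈1 {γ} γ≋̸0
      exact : ∃[ n ] (0 < n × HasOrder γ n) → HasOrder γ (p ℕ.+ 1)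
      exact (n , 0<n , o) = subst (HasOrder γ) (≡.trans (order-of-generator generates⇒Generator 0<n o
        point point-valid point-injective point-surjective) (ℕ.+-comm 1 p)) o

  abstract
    generator : ∃[ γ ] (Generator γ × HasOrder γ (p ℕ.+ 1))
    generator = from-cyclic 𝔽².cyclic
      where
      from-cyclic : ∃[ γ ] (¬ γ ≋₂ (0ℤ , 0ℤ)
        × (∀ x → ¬ x ≋₂ (0ℤ , 0ℤ) → ∃[ i ] Orders._^_ *-commutativeMonoid γ i ≋₂ x)) →
        ∃[ γ ] (Generator γ × HasOrder γ (p ℕ.+ 1))
      from-cyclic (γ , γ≋̸0 , gen) = γ , generates⇒Generator {γ} γ≋̸0 gen , generates⇒order {γ} γ≋̸0 gen

  -- Powers of θ and the isomorphism induced by w₁ - w₀θ.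

  θ : Pair
  θ = (0ℤ , 1ℤ)

  θ-valid : Valid θ
  θ-valid (_ , d) = ∤1 d

  θ^≡θpow : ∀ k → θ ^ k ≡ θpow P Q k
  θ^≡θpow zero    = ≡.refl
  θ^≡θpow (suc k) = cong (θ ·_) (θ^≡θpow k)

  -- Multiplication by θ² = Pθ - Q gives the θ-coordinates the Lucas recurrence; two consecutive
  -- values are carried because it has order two.
  θpow-lucas : ∀ k → (proj₂ (θpow P Q k) ≡ lucas P Q k) × (proj₂ (θpow P Q (suc k)) ≡ lucas P Q (suc k))
  θpow-lucas zero    = ≡.refl , lemma P
    where
    lemma : ∀ P → 0ℤ * 0ℤ + 1ℤ * 1ℤ + P * 1ℤ * 0ℤ ≡ 1ℤ
    lemma = solve-∀
  θpow-lucas (suc k) = let e₀ , e₁ = θpow-lucas k in e₁ ,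
    ≡.trans (step (θpow P Q k)) (cong₂ (λ s t → P * s - Q * t) e₁ e₀)
    where
    lemma : ∀ P Q a b → 0ℤ * (0ℤ * b + 1ℤ * a + P * 1ℤ * b) + 1ℤ * (0ℤ * a - Q * 1ℤ * b) + P * 1ℤ * (0ℤ * b + 1ℤ * a + P * 1ℤ * b)
      ≡ P * (0ℤ * b + 1ℤ * a + P * 1ℤ * b) - Q * b
    lemma = solve-∀
    step : ∀ x → proj₂ (θ · (θ · x)) ≡ P * proj₂ (θ · x) - Q * proj₂ x
    step (a , b) = lemma P Q a b

  θ^≈1⇔ : ∀ k → (θ ^ k ≈₁ 1₂) ⇔ (+ p) ∣ lucas P Q k
  θ^≈1⇔ k = subst (λ l → (θ ^ k ≈₁ 1₂) ⇔ (+ p) ∣ l)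
    (≡.trans (cong proj₂ (θ^≡θpow k)) (proj₁ (θpow-lucas k)))
    (≈₁1⇔ (θ ^ k) (^-valid {θ} θ-valid k))

  unit⇒valid : ∀ x → Unit x → Valid (φ1 x)
  unit⇒valid (a , b) ux (d , d′) = ux (≋0⇒∣ (≋0⇒Λ≋0 a b (∣⇒≋0 {a} d) (≋-trans (≡⇒≋ (≡.sym (ℤ.neg-involutive b)))
    (-‿cong (∣⇒≋0 { - b} d′)))))

  cross⇒scaled : ∀ a b c d → a * d ≡ b * c → ¬ (+ p) ∣ c → ∃[ l ] ((a ≋ l * c) × (b ≋ l * d))
  cross⇒scaled a b c d ad≡bc p∤c = a * i , e₁ , e₂
    where
    open import Relation.Binary.Reasoning.Setoid (CommutativeRing.setoid ℤ/n)
    i : ℤ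
    i = inv p c
    lemma₁ : ∀ a c i → a * (c * i) ≡ a * i * c
    lemma₁ = solve-∀
    lemma₂ : ∀ a d i → (a * d) * i ≡ a * i * d
    lemma₂ = solve-∀
    e₁ : a ≋ a * i * c
    e₁ = begin
      a              ≡⟨ ℤ.*-identityʳ a ⟨
      a * 1ℤ         ≈⟨ *-cong (≋-refl {a}) (inv-* c p∤c) ⟨
      a * (c * i)    ≡⟨ lemma₁ a c i ⟩
      a * i * c      ∎
    e₂ : b ≋ a * i * d
    e₂ = begin
      b              ≡⟨ ℤ.*-identityʳ b ⟨
      b * 1ℤ         ≈⟨ *-cong (≋-refl {b}) (inv-* c p∤c) ⟨
      b * (c * i)    ≡⟨ ℤ.*-assoc b c i ⟨
      (b * c) * i    ≡⟨ cong (λ s → s * i) ad≡bc ⟨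
      (a * d) * i    ≡⟨ lemma₂ a d i ⟩
      a * i * d      ∎

  -- The scalar is a / c, or b / d when p ∣ c; validity of (c, d) leaves one of the two available,
  -- and validity of (a, b) makes the scalar a unit.
  cross⇒≈₁ : ∀ a b c d → Valid (a , b) → Valid (c , d) → a * d ≡ b * c → (a , b) ≈₁ (c , d)
  cross⇒≈₁ a b c d vx vy ad≡bc = by-cases (p ℕ.∣? ∣ c ∣)
    where
    build : ∀ l → a ≋ l * c → b ≋ l * d → (a , b) ≈₁ (c , d)
    build l e₁ e₂ = scaled l (λ p∣l → vx ( ≋0⇒∣ (≋-trans e₁ (∣⇒≋0 {l * c} (∣-*ˡ l c p∣l)))
                                         , ≋0⇒∣ (≋-trans e₂ (∣⇒≋0 {l * d} (∣-*ˡ l d p∣l))))) (e₁ , e₂)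
    by-cases : Dec ((+ p) ∣ c) → (a , b) ≈₁ (c , d)
    by-cases (no p∤c)  = let l , e₁ , e₂ = cross⇒scaled a b c d ad≡bc p∤c in build l e₁ e₂
    by-cases (yes p∣c) = let l , e₂ , e₁ = cross⇒scaled b a d c (≡.sym ad≡bc) (λ p∣d → vy (p∣c , p∣d)) in build l e₁ e₂

  φ1-cong : ∀ x y → Unit x → Unit y → x ∼ y → φ1 x ≈₁ φ1 y
  φ1-cong x@(a , b) y@(c , d) ux uy ad≡bc = cross⇒≈₁ a (- b) c (- d) (unit⇒valid x ux) (unit⇒valid y uy)
    (≡.trans (≡.sym (ℤ.neg-distribʳ-* a d)) (≡.trans (cong -_ ad≡bc) (ℤ.neg-distribˡ-* b c)))

  -- The sign change is an involution, so it carries t to its own preimage; that pair has unit Λ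
  -- because the norm vanishes modulo p only at 0.
  φ1-surj : ∀ t → Valid t → ∃[ x ] (Unit x × φ1 x ≈₁ t)
  φ1-surj t v = φ1 t , (λ d → valid⇒≋̸0 t v (norm≋0⇒≋0 t (∣⇒≋0 {norm t} d))) , ≡⇒≈₁ (φ1-involutive t)

  φ1-ker : ∀ x → Unit x → (φ1 x ≈₁ 1₂) ⇔ (+ p) ∣ proj₂ x
  φ1-ker x@(a , b) ux = mk⇔
    (λ e → subst (p ℕ.∣_) (ℤ.∣-i∣≡∣i∣ b) (to (≈₁1⇔ (φ1 x) (unit⇒valid x ux)) e))
    (λ d → from (≈₁1⇔ (φ1 x) (unit⇒valid x ux)) (subst (p ℕ.∣_) (≡.sym (ℤ.∣-i∣≡∣i∣ b)) d))

  unitIso : UnitIso 𝔽ₚ[θ]×/𝔽ₚ× φ1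
  unitIso = record
    { isEquivalence = record { refl = ≡⇒≈₁ ≡.refl ; sym = ≈₁-sym ; trans = ≈₁-trans }
    ; φ-valid = unit⇒valid ; φ-cong = φ1-cong
    ; φ-homo = λ x y _ _ → ≡⇒≈₁ (φ1-homo x y)
    ; φ-surj = φ1-surj ; φ-ker = φ1-ker }

  -- (P - θ)θ = Q because θ² = Pθ - Q, and Q is a nonzero scalar as p ∤ Q.
  φσθ≈1 : φ1 σ · θ ≈₁ 1₂
  φσθ≈1 = scaled Q p∤Q (≡⇒≋ (lemma₁ P Q) , ≡⇒≋ (lemma₂ P Q))
    where
    lemma₁ : ∀ P Q → P * 0ℤ - Q * (- 1ℤ) * 1ℤ ≡ Q * 1ℤ
    lemma₁ = solve-∀
    lemma₂ : ∀ P Q → P * 1ℤ + (- 1ℤ) * 0ℤ + P * (- 1ℤ) * 1ℤ ≡ Q * 0ℤ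
    lemma₂ = solve-∀

  ≈₁⇒T1 : ∀ x y → x ≈₁ y → TGrp._≈_ (T1 P Q p) x y
  ≈₁⇒T1 (a , b) (c , d) (scaled l p∤l (e , f)) = l , p∤l , un e , un f

  T1⇒≈₁ : ∀ x y → TGrp._≈_ (T1 P Q p) x y → x ≈₁ y
  T1⇒≈₁ (a , b) (c , d) (l , p∤l , e , f) = scaled l p∤l (mk {a} {l * c} e , mk {b} {l * d} f)

  T1*⇔ : ∀ x y → TGrp._≈_ (T1* P Q p) x y ⇔ (∃[ k ] x ≈₁ (θ ^ k) · y)
  T1*⇔ x y = mk⇔
    (λ (l , k , p∤l , e) → k , subst (λ z → x ≈₁ z · y) (≡.sym (θ^≡θpow k))
                                 (T1⇒≈₁ x (θpow P Q k · y) (l , p∤l , e)))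
    (λ (k , e) → let l , p∤l , e′ = ≈₁⇒T1 x (θpow P Q k · y) (subst (λ z → x ≈₁ z · y) (θ^≡θpow k) e)
                 in l , k , p∤l , e′)

  isoVia : IsoVia P Q (inK P Q p) _∼_ (inG P Q p) (T1 P Q p) φ1
  isoVia = IsoVia-≈ {𝔽ₚ[θ]×/𝔽ₚ×} (TGrp._≈_ (T1 P Q p)) ≈₁⇒T1 T1⇒≈₁ P Q (UnitIso.isoVia unitIso)

  0<p+1 : 0 < p ℕ.+ 1
  0<p+1 = ℕ.m≤n+m 1 p

  isCyclic : CyclicOfOrder (T1 P Q p) (p ℕ.+ 1)
  isCyclic = let γ , γ-generator , o = generator in
    CyclicOfOrder-≈ {𝔽ₚ[θ]×/𝔽ₚ×} (TGrp._≈_ (T1 P Q p)) ≈₁⇒T1 T1⇒≈₁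
      (generator⇒CyclicOfOrder {γ} γ-generator 0<p+1 o)

  module _ {r : ℕ} .{{_ : NonZero r}} (rank : IsRank P Q p r) where

    θ-order : HasOrder θ r
    θ-order = least⇒HasOrder (proj₁ rank) (from (θ^≈1⇔ r) (proj₁ (proj₂ rank)))
      (λ m 0<m m<r e → proj₂ (proj₂ rank) m 0<m m<r (to (θ^≈1⇔ m) e))

    ⟨θ⟩-quotient : CyclicQuotient laws
    ⟨θ⟩-quotient = record
      { h = θ ; h-valid = θ-valid ; r = r ; 0<r = proj₁ rank ; h-order = θ-order
      ; _≈*_ = TGrp._≈_ (T1* P Q p) ; ≈*⇔ = T1*⇔ }

    isoVia* : IsoVia P Q (inK P Q p) (λ x y → x ≈π[ P , Q ] y) (inGstar P Q p) (T1* P Q p) φ1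
    isoVia* = Star.isoVia* unitIso ⟨θ⟩-quotient φσθ≈1

    isCyclic* : CyclicOfOrder (T1* P Q p) ((p ℕ.+ 1) / r)
    isCyclic* = let γ , γ-generator , o = generator in
      Quotient.CyclicOfOrder-quotient ⟨θ⟩-quotient {γ} γ-generator 0<p+1 o

theorem9 : (P Q : ℤ) (p : ℕ) → ¬ (Q ≡ 0ℤ) → ¬ (disc P Q ≡ 0ℤ) → Prime p
    → ¬ ((+ p) ∣ Q) → (r : ℕ) → .{{_ : NonZero r}} → IsRank P Q p r
    → (Irreducible P Q p
        → IsoVia P Q (inK P Q p) _∼_ (inG P Q p) (T1 P Q p) φ1
          × CyclicOfOrder (T1 P Q p) (p ℕ.+ 1)
          × IsoVia P Q (inK P Q p) (λ x y → x ≈π[ P , Q ] y) (inGstar P Q p) (T1* P Q p) φ1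
          × CyclicOfOrder (T1* P Q p) ((p ℕ.+ 1) / r))
    × (Reducible P Q p → ¬ ((+ p) ∣ disc P Q) → (u v : ℤ) → Factors P Q p u v
        → IsoVia P Q (inK P Q p) _∼_ (inG P Q p) (T2 p) (φ2 p u v)
          × CyclicOfOrder (T2 p) (p ∸ 1)
          × IsoVia P Q (inK P Q p) (λ x y → x ≈π[ P , Q ] y) (inGstar P Q p) (T2* p u v) (φ2 p u v)
          × CyclicOfOrder (T2* p u v) ((p ∸ 1) / r))
    × (Reducible P Q p → (+ p) ∣ disc P Q
        → ((θ : ℤ) → Factors P Q p θ θ
            → IsoVia P Q (inK P Q p) _∼_ (inG P Q p) (T3 p) (φ3 p θ))
          × (∀ x → inK P Q p x → inGstar P Q p x))
theorem9 P Q p Q≢0 D≢0 p-prime p∤Q r rank =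
    (λ irreducible → let open Inert P Q p-prime p∤Q irreducible in
       isoVia , isCyclic , isoVia* rank , isCyclic* rank)
  , (λ _ p∤D u v factors → let open Distinct u v factors p∤D in
       isoVia , isCyclic , isoVia* rank , isCyclic* rank)
  -- K* = G* starts from an arbitrary factorisation; p ∣ D makes its root u double, so the
  -- double-root argument applies to u.
  , (λ (u , v , factors) p∣D →
         (λ θ factors → Double.isoVia θ factors)
       , Double.K⊆G* u (p∣disc⇒double-root u v factors p∣D))
  where open Split P Q p-prime p∤Q
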